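{- Let $\mathcal{S}$ be the set of Schur partitions, that is, integer partitions $\lambda=(\lambda_1\ge\cdots\ge\lambda_{\ell(\lambda)})$ such that for all $1\le i<\ell(\lambda)$ one has $\lambda_i-\lambda_{i+1}\ge 3$, with strict inequality if either $\lambda_i$ or $\lambda_{i+1}$ is a multiple of $3$. Let $f_{\mathcal{S}}(x)=f_{\mathcal{S}}(x;q):=\sum_{\lambda\in\mathcal{S}}x^{\ell(\lambda)}q^{|\lambda|}$. Then $$f_{\mathcal{S}}(x)=\sum_{m,n\ge 0}\frac{(-1)^n\,x^{m+2n}\,q^{3n(3n+2m)+\frac{m(3m-1)}{2}}}{(q;q)_m\,(q^6;q^6)_n}.$$
   Context: For an integer partition $\lambda$ with (positive integer) parts $\lambda_1\ge\cdots\ge\lambda_\ell$, its size is $|\lambda|=\lambda_1+\cdots+\lambda_\ell$ and its length is $\ell(\lambda)=\ell$ (the number of parts); the empty partition is allowed, with size and length $0$. For an integer $n\ge 0$, $(a;q)_n=\prod_{k=0}^{n-1}(1-aq^k)$. The identity may be read as an identity of formal power series in $q$ whose coefficients are polynomials in $x$ (equivalently, as an identity of convergent series for complex $x$ and $|q|<1$). -}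

module Defs where

open import Algebra.Bundles.Raw using (RawRing)
import Algebra.Definitions.RawMonoid as RawMonoidDefs
import Algebra.Definitions.RawSemiring as RawSemiringDefs
open import Data.Empty using (⊥; ⊥-elim)
open import Data.Fin.Base using (Fin; toℕ) renaming (zero to fzero; suc to fsuc)
open import Data.Integer.Base as ℤ using (ℤ; 0ℤ; 1ℤ)
import Data.Integer.Properties as ℤ
open import Data.List.Base using (List; []; _∷_; _++_; map; foldr; filter; length)
open import Data.List.Membership.Propositional using (_∈_; _∉_)
open import Data.List.Membership.Propositional.Properties
  using (∈-++⁺ˡ; ∈-++⁺ʳ; ∈-map⁺; ∈-map⁻; ∈-filter⁺)
open import Data.List.Properties using (∷-injectiveʳ)
open import Data.List.Relation.Unary.All as All using (All; []; _∷_)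
import Data.List.Relation.Unary.All.Properties as All
open import Data.List.Relation.Unary.AllPairs.Core using ([]; _∷_)
open import Data.List.Relation.Unary.Any using (here)
open import Data.List.Relation.Unary.Linked using (Linked; linked?)
open import Data.List.Relation.Unary.Unique.Propositional using (Unique)
import Data.List.Relation.Unary.Unique.Propositional.Properties as Unique
open import Data.Nat.Base using (ℕ; zero; suc; _∸_; _≤_; _<_; _≥_; _>_; s≤s; z≤n) renaming (_+_ to _+ⁿ_)
open import Data.Nat.Divisibility using (_∣_; _∣?_)
open import Data.Nat.ListAction using (sum)
import Data.Nat.Properties as ℕ
open import Data.Product.Base using (∃-syntax; _×_; _,_; proj₁; proj₂)
open import Data.Sum.Base using (_⊎_)
open import Level using (0ℓ)
open import Relation.Binary.PropositionalEquality
  using (_≡_; _≢_; refl; sym; trans; cong; cong₂; subst)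
open import Relation.Nullary using (Dec; yes; no)
open import Relation.Nullary.Decidable using (_×-dec_; _⊎-dec_; _→-dec_)
open import Relation.Unary using (Pred; Decidable)

IsPartition : Pred (List ℕ) 0ℓ
IsPartition λs = All (0 <_) λs × Linked _≥_ λs

-- Truncated subtraction is harmless: 3 ≤ a ∸ b forces b < a.
SchurGap : ℕ → ℕ → Set
SchurGap a b = a ∸ b ≥ 3 × (3 ∣ a ⊎ 3 ∣ b → a ∸ b > 3)

IsSchur : Pred (List ℕ) 0ℓ
IsSchur λs = IsPartition λs × Linked SchurGap λs

isPartition? : Decidable IsPartition
isPartition? λs = All.all? (0 ℕ.<?_) λs ×-dec linked? (λ a b → b ℕ.≤? a) λs

schurGap? : ∀ a b → Dec (SchurGap a b)
schurGap? a b = (3 ℕ.≤? a ∸ b) ×-dec (((3 ∣? a) ⊎-dec (3 ∣? b)) →-dec (3 ℕ.<? a ∸ b))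

isSchur? : Decidable IsSchur
isSchur? λs = isPartition? λs ×-dec linked? schurGap? λs

-- Compositions of 1 + a + n whose first part is at least 1 + a.
compositionsFrom : ℕ → ℕ → List (List ℕ)
compositionsFrom a zero    = (suc a ∷ []) ∷ []
compositionsFrom a (suc n) = compositionsFrom (suc a) n ++ map (suc a ∷_) (compositionsFrom 0 n)

compositions : ℕ → List (List ℕ)
compositions zero    = [] ∷ []
compositions (suc n) = compositionsFrom 0 n

schurPartitions : ℕ → List (List ℕ)
schurPartitions n = filter isSchur? (compositions n)

-- Coefficients in order of increasing degree; trailing zeros are allowed,
-- so equality of polynomials is _≈ₚ_ and not _≡_.
Poly : Set
Poly = List ℤ

coeff : Poly → ℕ → ℤ
coeff []      _       = 0ℤ
coeff (a ∷ p) zero    = a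
coeff (a ∷ p) (suc k) = coeff p k

infix 4 _≈ₚ_
record _≈ₚ_ (p r : Poly) : Set where
  constructor coeffwise
  field at : ∀ k → coeff p k ≡ coeff r k
open _≈ₚ_ public

infixl 6 _+ₚ_
_+ₚ_ : Poly → Poly → Poly
[]      +ₚ r       = r
(a ∷ p) +ₚ []      = a ∷ p
(a ∷ p) +ₚ (b ∷ r) = (a ℤ.+ b) ∷ (p +ₚ r)

infixl 7 _*ₚ_
_*ₚ_ : Poly → Poly → Poly
[]      *ₚ r = []
(a ∷ p) *ₚ r = map (a ℤ.*_) r +ₚ (0ℤ ∷ p *ₚ r)

ℤ[x] : RawRing 0ℓ 0ℓ
ℤ[x] = record
  { Carrier = Poly
  ; _≈_     = _≈ₚ_
  ; _+_     = _+ₚ_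
  ; _*_     = _*ₚ_
  ; -_      = map (λ a → ℤ.- a)
  ; 0#      = []
  ; 1#      = 1ℤ ∷ []
  }

private module P where
  open RawRing ℤ[x] public
  open RawSemiringDefs rawSemiring public using (_^_)

X : Poly
X = 0ℤ ∷ 1ℤ ∷ []

-- A series is its sequence of coefficients, multiplied by convolution.
infix 9 _⟦q⟧
_⟦q⟧ : RawRing 0ℓ 0ℓ → RawRing 0ℓ 0ℓ
R ⟦q⟧ = record
  { Carrier = ℕ → R.Carrier
  ; _≈_     = λ f g → ∀ n → f n R.≈ g n
  ; _+_     = λ f g n → f n R.+ g n
  ; _*_     = λ f g n → Sum.sum {suc n} (λ i → f (toℕ i) R.* g (n ∸ toℕ i))
  ; -_      = λ f n → R.- f n
  ; 0#      = λ _ → R.0#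
  ; 1#      = λ { zero → R.1# ; (suc _) → R.0# }
  }
  where
  module R = RawRing R
  module Sum = RawMonoidDefs R.+-rawMonoid

-- The operations of ℤ[x]⟦q⟧ are renamed because those of ℕ occur in exponents.
open RawRing (ℤ[x] ⟦q⟧) public
  using ()
  renaming ( Carrier to Series ; _≈_ to _≈ˢ_ ; _+_ to _⊕_ ; _*_ to _⊙_
           ; -_ to ⊖_ ; 0# to 0ˢ ; 1# to 1ˢ )

open RawSemiringDefs (RawRing.rawSemiring (ℤ[x] ⟦q⟧)) public
  using () renaming (_^_ to _↑_)

x : Series
x zero    = X
x (suc _) = P.0#

q : Series
q zero          = P.0#
q (suc zero)    = P.1#
q (suc (suc _)) = P.0#

-- 1/f = Σₖ (1 - f)ᵏ, for f with constant term 1.  Then (1 - f)ᵏ has no terms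
-- below qᵏ, so only k ≤ n contribute to the coefficient of qⁿ.  The value is
-- meaningless for other f.
infix 8 1/_
1/_ : Series → Series
(1/ f) n = RawMonoidDefs.sum P.+-rawMonoid {suc n} (λ k → ((1ˢ ⊕ (⊖ f)) ↑ toℕ k) n)

-- (a;b)ₙ
infix 9 ⟨_⨾_⟩_
⟨_⨾_⟩_ : Series → Series → ℕ → Series
⟨ a ⨾ b ⟩ zero  = 1ˢ
⟨ a ⨾ b ⟩ suc n = (⟨ a ⨾ b ⟩ n) ⊙ (1ˢ ⊕ (⊖ (a ⊙ b ↑ n)))

-- HasSum S F s: the family (F i), i ∈ S, is summable in ℤ[x]⟦q⟧ with sum s.
-- That is, for each n only finitely many i ∈ S have a non-zero coefficient of
-- qⁿ in F i, and these coefficients add up to that of s.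
HasSum : {I : Set} → Pred I 0ℓ → (I → Series) → Series → Set
HasSum {I} S F s = ∀ n → ∃[ is ]
    Unique is
  × All S is
  × (∀ i → S i → i ∉ is → F i n P.≈ P.0#)
  × s n P.≈ foldr P._+_ P.0# (map (λ i → F i n) is)

-- f_S(x;q), through its coefficients in q.  That it is the sum over all Schur
-- partitions is fS-hasSum below.
fS : Series
fS n = foldr P._+_ P.0# (map (λ λs → X P.^ length λs) (schurPartitions n))

private
  coeff-+ : ∀ p r k → coeff (p +ₚ r) k ≡ coeff p k ℤ.+ coeff r k
  coeff-+ []      r       k       = sym (ℤ.+-identityˡ _)
  coeff-+ (a ∷ p) []      k       = sym (ℤ.+-identityʳ _)
  coeff-+ (a ∷ p) (b ∷ r) zero    = refl
  coeff-+ (a ∷ p) (b ∷ r) (suc k) = coeff-+ p r k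

  coeff-map : ∀ a p k → coeff (map (a ℤ.*_) p) k ≡ a ℤ.* coeff p k
  coeff-map a []      k       = sym (ℤ.*-zeroʳ a)
  coeff-map a (b ∷ p) zero    = refl
  coeff-map a (b ∷ p) (suc k) = coeff-map a p k

  ≈-refl : ∀ {p} → p ≈ₚ p
  ≈-refl .at k = refl

  ≈-sym : ∀ {p r} → p ≈ₚ r → r ≈ₚ p
  ≈-sym e .at k = sym (e .at k)

  ≈-trans : ∀ {p r s} → p ≈ₚ r → r ≈ₚ s → p ≈ₚ s
  ≈-trans e e′ .at k = trans (e .at k) (e′ .at k)

  ≈-reflexive : ∀ {p r} → p ≡ r → p ≈ₚ r
  ≈-reflexive refl = ≈-refl

  +-cong : ∀ {p p′ r r′} → p ≈ₚ p′ → r ≈ₚ r′ → p +ₚ r ≈ₚ p′ +ₚ r′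
  +-cong {p} {p′} {r} {r′} e e′ .at k =
    trans (coeff-+ p r k) (trans (cong₂ ℤ._+_ (e .at k) (e′ .at k)) (sym (coeff-+ p′ r′ k)))

  +-identityʳ : ∀ p → p +ₚ [] ≡ p
  +-identityʳ []      = refl
  +-identityʳ (a ∷ p) = refl

  ∷-cong : ∀ {a b p r} → a ≡ b → p ≈ₚ r → a ∷ p ≈ₚ b ∷ r
  ∷-cong e e′ .at zero    = e
  ∷-cong e e′ .at (suc k) = e′ .at k

  0∷ : ∀ {p} → p ≈ₚ [] → 0ℤ ∷ p ≈ₚ []
  0∷ e .at zero    = refl
  0∷ e .at (suc k) = e .at k

  tail-≈ : ∀ {a b p r} → a ∷ p ≈ₚ b ∷ r → p ≈ₚ r
  tail-≈ e .at k = e .at (suc k)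

  tail-0 : ∀ {a p} → a ∷ p ≈ₚ [] → p ≈ₚ []
  tail-0 e .at k = e .at (suc k)

  map-cong : ∀ a {r r′} → r ≈ₚ r′ → map (a ℤ.*_) r ≈ₚ map (a ℤ.*_) r′
  map-cong a {r} {r′} e .at k =
    trans (coeff-map a r k) (trans (cong (a ℤ.*_) (e .at k)) (sym (coeff-map a r′ k)))

  *-congˡ : ∀ p {r r′} → r ≈ₚ r′ → p *ₚ r ≈ₚ p *ₚ r′
  *-congˡ []      e = ≈-refl
  *-congˡ (a ∷ p) e = +-cong (map-cong a e) (∷-cong refl (*-congˡ p e))

  *-zeroʳ : ∀ p → p *ₚ [] ≈ₚ []
  *-zeroʳ []      = ≈-refl
  *-zeroʳ (a ∷ p) = 0∷ (*-zeroʳ p)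

  map-zero : ∀ {a} r → a ≡ 0ℤ → map (a ℤ.*_) r ≈ₚ []
  map-zero {a} r e .at k = trans (coeff-map a r k) (cong (ℤ._* coeff r k) e)

  *-zeroˡ : ∀ p r → p ≈ₚ [] → p *ₚ r ≈ₚ []
  *-zeroˡ []      r e = ≈-refl
  *-zeroˡ (a ∷ p) r e = +-cong (map-zero r (e .at 0)) (0∷ (*-zeroˡ p r (tail-0 e)))

  *-congʳ : ∀ {p p′} r → p ≈ₚ p′ → p *ₚ r ≈ₚ p′ *ₚ r
  *-congʳ {[]}    {p′}     r e = ≈-sym (*-zeroˡ p′ r (≈-sym e))
  *-congʳ {a ∷ p} {[]}     r e = *-zeroˡ (a ∷ p) r e
  *-congʳ {a ∷ p} {b ∷ p′} r e = +-cong
    (≈-reflexive (cong (λ c → map (c ℤ.*_) r) (e .at 0)))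
    (∷-cong refl (*-congʳ r (tail-≈ e)))

  *-identityʳ : ∀ p → p *ₚ P.1# ≈ₚ p
  *-identityʳ []      = ≈-refl
  *-identityʳ (a ∷ p) = ∷-cong (trans (ℤ.+-identityʳ _) (ℤ.*-identityʳ a)) (*-identityʳ p)

  map-id : ∀ p → map (1ℤ ℤ.*_) p ≈ₚ p
  map-id p .at k = trans (coeff-map 1ℤ p k) (ℤ.*-identityˡ _)

  *-identityˡ : ∀ p → P.1# *ₚ p ≈ₚ p
  *-identityˡ p = ≈-trans (+-cong (map-id p) (0∷ ≈-refl)) (≈-reflexive (+-identityʳ p))

  sumP : ∀ {n} → (Fin n → Poly) → Poly
  sumP = RawMonoidDefs.sum P.+-rawMonoid

  sumP-zero : ∀ {n} (t : Fin n → Poly) → (∀ i → t i ≈ₚ []) → sumP t ≈ₚ []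
  sumP-zero {zero}  t e = ≈-refl
  sumP-zero {suc n} t e = +-cong (e fzero) (sumP-zero (λ i → t (fsuc i)) (λ i → e (fsuc i)))

  const-⊙ : ∀ f g → (∀ i → f (suc i) ≈ₚ []) → ∀ n → (f ⊙ g) n ≈ₚ f 0 *ₚ g n
  const-⊙ f g e n = ≈-trans
    (+-cong ≈-refl (sumP-zero {n} _ (λ i → *-zeroˡ (f (suc (toℕ i))) (g (n ∸ suc (toℕ i))) (e (toℕ i)))))
    (≈-reflexive (+-identityʳ (f 0 *ₚ g n)))

  x↑-suc : ∀ l i → (x ↑ l) (suc i) ≈ₚ []
  x↑-suc zero    i = ≈-refl
  x↑-suc (suc l) i = ≈-trans (const-⊙ x (x ↑ l) (λ _ → ≈-refl) (suc i))
    (≈-trans (*-congˡ X (x↑-suc l i)) (*-zeroʳ X))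

  x↑-zero : ∀ l → (x ↑ l) 0 ≈ₚ X P.^ l
  x↑-zero zero    = ≈-refl
  x↑-zero (suc l) = ≈-trans (const-⊙ x (x ↑ l) (λ _ → ≈-refl) 0) (*-congˡ X (x↑-zero l))

  q⊙-suc : ∀ g n → (q ⊙ g) (suc n) ≈ₚ g n
  q⊙-suc g n = ≈-trans
    (+-cong (*-identityˡ (g n)) (sumP-zero {n} _ (λ _ → ≈-refl)))
    (≈-reflexive (+-identityʳ (g n)))

  q↑-diag : ∀ n → (q ↑ n) n ≈ₚ P.1#
  q↑-diag zero    = ≈-refl
  q↑-diag (suc n) = ≈-trans (q⊙-suc (q ↑ n) n) (q↑-diag n)

  q↑-off : ∀ m n → m ≢ n → (q ↑ m) n ≈ₚ []
  q↑-off zero    zero    m≢n = ⊥-elim (m≢n refl)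
  q↑-off zero    (suc n) m≢n = ≈-refl
  q↑-off (suc m) zero    m≢n = ≈-refl
  q↑-off (suc m) (suc n) m≢n =
    ≈-trans (q⊙-suc (q ↑ m) n) (q↑-off m n (λ e → m≢n (cong suc e)))

  monomial : ∀ l m n → (x ↑ l ⊙ q ↑ m) n ≈ₚ X P.^ l *ₚ (q ↑ m) n
  monomial l m n = ≈-trans (const-⊙ (x ↑ l) (q ↑ m) (x↑-suc l) n) (*-congʳ ((q ↑ m) n) (x↑-zero l))

  monomial-diag : ∀ l n → (x ↑ l ⊙ q ↑ n) n ≈ₚ X P.^ l
  monomial-diag l n = ≈-trans (monomial l n n)
    (≈-trans (*-congˡ (X P.^ l) (q↑-diag n)) (*-identityʳ (X P.^ l)))

  monomial-off : ∀ l m n → m ≢ n → (x ↑ l ⊙ q ↑ m) n ≈ₚ []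
  monomial-off l m n m≢n = ≈-trans (monomial l m n)
    (≈-trans (*-congˡ (X P.^ l) (q↑-off m n m≢n)) (*-zeroʳ (X P.^ l)))

  FirstPart> : ℕ → List ℕ → Set
  FirstPart> a c = ∃[ b ] ∃[ c′ ] (c ≡ b ∷ c′ × a < b)

  compositionsFrom-first : ∀ a n → All (FirstPart> a) (compositionsFrom a n)
  compositionsFrom-first a zero    = (_ , _ , refl , ℕ.≤-refl) ∷ []
  compositionsFrom-first a (suc n) = All.++⁺
    (All.map (λ { (b , c′ , e , lt) → b , c′ , e , ℕ.<-trans ℕ.≤-refl lt }) (compositionsFrom-first (suc a) n))
    (All.map⁺ (All.universal (λ c → _ , c , refl , ℕ.≤-refl) (compositionsFrom 0 n)))

  compositionsFrom-unique : ∀ a n → Unique (compositionsFrom a n)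
  compositionsFrom-unique a zero    = [] ∷ []
  compositionsFrom-unique a (suc n) = Unique.++⁺
    (compositionsFrom-unique (suc a) n)
    (Unique.map⁺ ∷-injectiveʳ (compositionsFrom-unique 0 n))
    λ { (c∈ , c∈′) → disjoint (All.lookup (compositionsFrom-first (suc a) n) c∈) (∈-map⁻ (suc a ∷_) c∈′) }
    where
    disjoint : ∀ {c} {A : List ℕ → Set} → FirstPart> (suc a) c → ∃[ t ] (A t × c ≡ suc a ∷ t) → ⊥
    disjoint (_ , _ , refl , lt) (_ , _ , refl) = ℕ.<-irrefl refl lt

  compositionsFrom-sum : ∀ a n → All (λ c → sum c ≡ suc (a +ⁿ n)) (compositionsFrom a n)
  compositionsFrom-sum a zero    = refl ∷ []
  compositionsFrom-sum a (suc n) = All.++⁺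
    (All.map (λ e → trans e (cong suc (sym (ℕ.+-suc a n)))) (compositionsFrom-sum (suc a) n))
    (All.map⁺ (All.map (λ e → cong (suc a +ⁿ_) e) (compositionsFrom-sum 0 n)))

  compositionsFrom-complete : ∀ a d c → All (0 <_) c → (suc (a +ⁿ d) ∷ c) ∈ compositionsFrom a (d +ⁿ sum c)
  compositionsFrom-complete a zero [] [] =
    here (cong (λ k → suc k ∷ []) (ℕ.+-identityʳ a))
  compositionsFrom-complete a zero (suc b ∷ c) (_ ∷ ps)
    rewrite ℕ.+-identityʳ a =
    ∈-++⁺ʳ (compositionsFrom (suc a) (b +ⁿ sum c)) (∈-map⁺ (suc a ∷_) (compositionsFrom-complete 0 b c ps))
  compositionsFrom-complete a (suc d) c ps
    rewrite ℕ.+-suc a d =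
    ∈-++⁺ˡ (compositionsFrom-complete (suc a) d c ps)

  compositions-unique : ∀ n → Unique (compositions n)
  compositions-unique zero    = [] ∷ []
  compositions-unique (suc n) = compositionsFrom-unique 0 n

  compositions-sum : ∀ n → All (λ c → sum c ≡ n) (compositions n)
  compositions-sum zero    = refl ∷ []
  compositions-sum (suc n) = compositionsFrom-sum 0 n

  compositions-complete : ∀ c → All (0 <_) c → c ∈ compositions (sum c)
  compositions-complete []          []       = here refl
  compositions-complete (suc b ∷ c) (_ ∷ ps) = compositionsFrom-complete 0 b c ps

  foldr-cong : ∀ {A : Set} {f g : A → Poly} {as} → All (λ a → f a ≈ₚ g a) as →
               foldr _+ₚ_ [] (map f as) ≈ₚ foldr _+ₚ_ [] (map g as)
  foldr-cong []       = ≈-refl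
  foldr-cong (e ∷ es) = +-cong e (foldr-cong es)

fS-hasSum : HasSum IsSchur (λ λs → x ↑ length λs ⊙ q ↑ sum λs) fS
fS-hasSum n = schurPartitions n
  , Unique.filter⁺ isSchur? (compositions-unique n)
  , All.all-filter isSchur? (compositions n)
  , outside
  , foldr-cong (All.map (λ {λs} e → ≈-sym (subst (λ m → (x ↑ length λs ⊙ q ↑ m) n ≈ₚ X P.^ length λs)
                                           (sym e) (monomial-diag (length λs) n)))
                        (All.filter⁺ isSchur? (compositions-sum n)))
  where
  outside : ∀ λs → IsSchur λs → λs ∉ schurPartitions n → (x ↑ length λs ⊙ q ↑ sum λs) n ≈ₚ []
  outside λs s ∉ = monomial-off (length λs) (sum λs) n
    λ { refl → ∉ (∈-filter⁺ isSchur? (compositions-complete λs (proj₁ (proj₁ s))) s) }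

{-# OPTIONS --safe #-}
-- Grade by the number l of parts, and let A l, C l, B l enumerate by size the
-- Schur partitions into l parts that are all > 0, > 1, > 2 respectively.
-- Removing a smallest part 1, 2 or 3, and subtracting 3 from every part if all
-- are > 3, gives
--   A (l+1) = q³ˡ⁺¹ A l + C (l+1),   C (l+1) = q³ˡ⁺² C l + B (l+1),
--   B (l+1) = q³ˡ⁺³ A (l+1) + q⁶ˡ⁺³ A l,
-- which determines all three, since 1 - q³ˡ⁺³ is invertible.  For the summand
-- qTerm m n of the double series (without its power of x), the sums
-- L k l = Σ qᵏᵐ qTerm m n over m + 2n = l, for k = 0, 1, 2, solve the same system:
-- (1 - qᵐ) qTerm m n is a multiple of qTerm (m-1) n, and it relates L k to L (k+1);
-- on m + 2n = l one has q³ᵐ - q³ˡ = q³ᵐ (1 - q⁶ⁿ), and (1 - q⁶ⁿ) qTerm m n is a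
-- multiple of qTerm m (n-1), so L 3 is expressed by L 0.  The equation for L 2 then
-- follows by induction on l.
module Submission where

open import Defs
open import Data.Nat.Base using (ℕ; _+_; _*_; _∸_; _/_)
open import Data.Product.Base using (_×_; uncurry)
open import Relation.Unary using (U)

open import Algebra.Bundles using (CommutativeRing; CommutativeSemiring)
open import Algebra.Bundles.Raw using (RawRing)
import Algebra.Construct.Pointwise as Pointwise
import Algebra.Definitions.RawMonoid as RawMonoidDefs
import Algebra.Definitions.RawSemiring as RawSemiringDefs
import Algebra.Morphism.RingMonomorphism as RingMonomorphism
open import Algebra.Morphism.Structures using (IsRingMonomorphism)
import Algebra.Properties.CommutativeSemigroup as CommutativeSemigroupProperties
import Algebra.Properties.Ring as RingProperties
import Algebra.Properties.Semiring.Exp as Exp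
import Algebra.Solver.Ring.NaturalCoefficients.Default as SemiringSolver
open import Data.Bool.Base using (T; if_then_else_; true; false)
open import Data.Fin.Base using (toℕ)
import Data.Integer.Base as ℤ
import Data.Integer.Properties as ℤ
open import Data.List.Base using (List; []; _∷_; _++_; map; foldr; filter; length)
open import Data.List.Membership.Propositional using (_∈_)
open import Data.List.Membership.Propositional.Properties using (∈-++⁺ˡ; ∈-++⁺ʳ; ∈-map⁺)
open import Data.List.Relation.Unary.All as All using (All; []; _∷_)
import Data.List.Relation.Unary.All.Properties as All
open import Data.List.Relation.Unary.AllPairs.Core using ([]; _∷_)
open import Data.List.Relation.Unary.Any using (here; there)
open import Data.List.Relation.Unary.Linked using ([]; [-]; _∷_)
open import Data.List.Relation.Unary.Unique.Propositional using (Unique)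
import Data.List.Relation.Unary.Unique.Propositional.Properties as Unique
open import Data.Nat.Base as ℕ using (zero; suc; _≤_; _<_; _≤ᵇ_; _<ᵇ_; _≡ᵇ_; z≤n; s≤s)
open import Data.Nat.Divisibility using (_∣_; _∣?_; ∣m+n∣m⇒∣n; ∣m∣n⇒∣m+n; ∣-refl; n∣m*n)
open import Data.Nat.DivMod using (+-distrib-/-∣ʳ; m*n/n≡m)
import Data.Nat.Properties as ℕ
open import Data.Nat.Tactic.RingSolver using (solve-∀)
open import Data.Product.Base using (_,_; proj₁; proj₂; map₂)
open import Data.Sum.Base using (_⊎_; inj₁; inj₂; [_,_]′)
open import Data.Unit.Base using (⊤)
open import Function.Base using (id)
open import Level using (0ℓ)
open import Relation.Binary.Definitions using (tri<; tri≈; tri>)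
open import Relation.Binary.PropositionalEquality as ≡ using (_≡_; _≢_)
import Relation.Binary.Reasoning.Setoid as SetoidReasoning
open import Relation.Nullary using (Dec; yes; no; ¬_; does; contradiction)
open import Relation.Nullary.Decidable using (from-no)
open import Relation.Unary using (Pred; Decidable)

-- Weights of index pairs, and the gap condition as a bound on the next part.

weight : ℕ → ℕ → ℕ
weight m n = m + 2 * n

weight-suc : ∀ m n → weight m (suc n) ≡ 2 + weight m n
weight-suc = lemma
  where
  lemma : ∀ m n → m + 2 * (1 + n) ≡ 2 + (m + 2 * n)
  lemma = solve-∀

-- The largest part that may follow a part 1 + M in a Schur partition; 0 if there is none.
maxNext : ℕ → ℕ
maxNext 0 = 0
maxNext 1 = 0
maxNext 2 = 0
maxNext 3 = 1
maxNext 4 = 2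
maxNext 5 = 2
maxNext (suc (suc (suc M@(suc (suc (suc _)))))) = 3 + maxNext M

maxNext≤ : ∀ M → maxNext M ≤ M
maxNext≤ 0 = z≤n
maxNext≤ 1 = z≤n
maxNext≤ 2 = z≤n
maxNext≤ 3 = s≤s z≤n
maxNext≤ 4 = s≤s (s≤s z≤n)
maxNext≤ 5 = s≤s (s≤s z≤n)
maxNext≤ (suc (suc (suc M@(suc (suc (suc _)))))) = s≤s (s≤s (s≤s (maxNext≤ M)))

-- A part 1 + M may be followed by a part > d exactly if M ≥ e.
Threshold : ℕ → ℕ → Set
Threshold d e = ∀ M → e ≤ M × d < maxNext M ⊎ M < e × maxNext M ≤ d

threshold-0-3 : Threshold 0 3
threshold-0-3 0 = inj₂ (s≤s z≤n , z≤n)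
threshold-0-3 1 = inj₂ (s≤s (s≤s z≤n) , z≤n)
threshold-0-3 2 = inj₂ (ℕ.≤-refl , z≤n)
threshold-0-3 3 = inj₁ (ℕ.≤-refl , s≤s z≤n)
threshold-0-3 4 = inj₁ (s≤s (s≤s (s≤s z≤n)) , s≤s z≤n)
threshold-0-3 5 = inj₁ (s≤s (s≤s (s≤s z≤n)) , s≤s z≤n)
threshold-0-3 (suc (suc (suc (suc (suc (suc _)))))) = inj₁ (s≤s (s≤s (s≤s z≤n)) , s≤s z≤n)

threshold-1-4 : Threshold 1 4
threshold-1-4 0 = inj₂ (s≤s z≤n , z≤n)
threshold-1-4 1 = inj₂ (s≤s (s≤s z≤n) , z≤n)
threshold-1-4 2 = inj₂ (s≤s (s≤s (s≤s z≤n)) , z≤n)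
threshold-1-4 3 = inj₂ (ℕ.≤-refl , ℕ.≤-refl)
threshold-1-4 4 = inj₁ (ℕ.≤-refl , ℕ.≤-refl)
threshold-1-4 5 = inj₁ (s≤s (s≤s (s≤s (s≤s z≤n))) , ℕ.≤-refl)
threshold-1-4 (suc (suc (suc (suc (suc (suc _)))))) = inj₁ (s≤s (s≤s (s≤s (s≤s z≤n))) , s≤s (s≤s z≤n))

-- Here `e` is 6 and not 5: a part 3 is a multiple of 3, so the gap above it exceeds 3 and the part
-- before it is at least 7.
threshold-2-6 : Threshold 2 6
threshold-2-6 0 = inj₂ (s≤s z≤n , z≤n)
threshold-2-6 1 = inj₂ (s≤s (s≤s z≤n) , z≤n)
threshold-2-6 2 = inj₂ (s≤s (s≤s (s≤s z≤n)) , z≤n)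
threshold-2-6 3 = inj₂ (s≤s (s≤s (s≤s (s≤s z≤n))) , s≤s z≤n)
threshold-2-6 4 = inj₂ (s≤s (s≤s (s≤s (s≤s (s≤s z≤n)))) , ℕ.≤-refl)
threshold-2-6 5 = inj₂ (ℕ.≤-refl , ℕ.≤-refl)
threshold-2-6 (suc (suc (suc (suc (suc (suc _)))))) =
  inj₁ (s≤s (s≤s (s≤s (s≤s (s≤s (s≤s z≤n))))) , s≤s (s≤s (s≤s z≤n)))

maxNext-3∣ : ∀ M → 3 ∣ suc M → maxNext M ≡ M ∸ 3
maxNext-3∣ 0 d = ≡.refl
maxNext-3∣ 1 d = ≡.refl
maxNext-3∣ 2 d = ≡.refl
maxNext-3∣ 3 d = contradiction d (from-no (3 ∣? 4))
maxNext-3∣ 4 d = contradiction d (from-no (3 ∣? 5))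
maxNext-3∣ 5 d = ≡.refl
maxNext-3∣ (suc (suc (suc M@(suc (suc (suc _)))))) d = ≡.cong (3 +_)
  (maxNext-3∣ M (∣m+n∣m⇒∣n {m = 3} d ∣-refl))

maxNext-3∤ : ∀ M → ¬ (3 ∣ suc M) → maxNext M ≡ M ∸ 2
maxNext-3∤ 0 d = ≡.refl
maxNext-3∤ 1 d = ≡.refl
maxNext-3∤ 2 d = contradiction ∣-refl d
maxNext-3∤ 3 d = ≡.refl
maxNext-3∤ 4 d = ≡.refl
maxNext-3∤ 5 d = contradiction (∣m∣n⇒∣m+n (∣-refl {3}) ∣-refl) d
maxNext-3∤ (suc (suc (suc M@(suc (suc (suc _)))))) d = ≡.cong (3 +_)
  (maxNext-3∤ M (λ d′ → d (∣m∣n⇒∣m+n (∣-refl {3}) d′)))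

-- Positivity of `m` excludes that `n ∸ o` was truncated.
0<m≤n∸o⇒m+o≤n : ∀ {m n o} → 0 < m → m ≤ n ∸ o → m + o ≤ n
0<m≤n∸o⇒m+o≤n {m} {n} {o} 0<m m≤n∸o = ℕ.m≤o∸n⇒m+n≤o m
  (ℕ.<⇒≤ (ℕ.m∸n≢0⇒n<m λ e → ℕ.<⇒≱ (ℕ.<-≤-trans 0<m m≤n∸o) (ℕ.≤-reflexive e))) m≤n∸o

SchurGap⇒≤maxNext : ∀ {M b} → SchurGap (suc M) b → b ≤ maxNext M
SchurGap⇒≤maxNext {M} {b} (gap , strict) with 3 ∣? suc M
... | yes 3∣ rewrite maxNext-3∣ M 3∣ = ℕ.m+n≤o⇒m≤o∸n b (≡.subst (_≤ M) (ℕ.+-comm 3 b)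
  (ℕ.s≤s⁻¹ (0<m≤n∸o⇒m+o≤n (s≤s z≤n) (strict (inj₁ 3∣)))))
... | no 3∤  rewrite maxNext-3∤ M 3∤ = ℕ.m+n≤o⇒m≤o∸n b (≡.subst (_≤ M) (ℕ.+-comm 2 b)
  (ℕ.s≤s⁻¹ (0<m≤n∸o⇒m+o≤n (s≤s z≤n) gap)))

-- The bound depends on the larger part alone: a gap of exactly 3 below a part not divisible by 3
-- ends in a part not divisible by 3, so the clause about `3 ∣ b` demands nothing new.
≤maxNext⇒SchurGap : ∀ {M b} → 0 < b → b ≤ maxNext M → SchurGap (suc M) b
≤maxNext⇒SchurGap {M} {b} 0<b b≤ with 3 ∣? suc M
... | yes 3∣ rewrite maxNext-3∣ M 3∣ = ℕ.<⇒≤ gap , λ _ → gap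
  where
  gap : 4 ≤ suc M ∸ b
  gap = ℕ.m+n≤o⇒m≤o∸n 4 (s≤s (≡.subst (_≤ M) (ℕ.+-comm b 3) (0<m≤n∸o⇒m+o≤n 0<b b≤)))
... | no 3∤  rewrite maxNext-3∤ M 3∤ = ℕ.m+n≤o⇒m≤o∸n 3 bound , strict
  where
  bound : 3 + b ≤ suc M
  bound = s≤s (≡.subst (_≤ M) (ℕ.+-comm b 2) (0<m≤n∸o⇒m+o≤n 0<b b≤))

  strict : 3 ∣ suc M ⊎ 3 ∣ b → 4 ≤ suc M ∸ b
  strict (inj₁ 3∣) = contradiction 3∣ 3∤
  strict (inj₂ 3∣b) = ℕ.m+n≤o⇒m≤o∸n 4
    (ℕ.≤∧≢⇒< bound λ e → 3∤ (≡.subst (3 ∣_) e (∣m∣n⇒∣m+n (∣-refl {3}) 3∣b)))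

-- The exponent of q in the double series.

pentagonal : ℕ → ℕ
pentagonal m = m * (3 * m ∸ 1) / 2

-- The numerator grows by `(1 + 3 * m) * 2`. An even summand can be split off from a truncated half,
-- so the parity of the rest never matters. The case `zero` is separate because `3 * m ∸ 1` only
-- unfolds for positive `m`.
pentagonal-suc : ∀ m → pentagonal (suc m) ≡ 1 + 3 * m + pentagonal m
pentagonal-suc zero      = ≡.refl
pentagonal-suc m@(suc k) = begin
  suc m * (m + 2 * suc m) / 2                          ≡⟨ ≡.cong (_/ 2) (lemma k) ⟩
  (m * (k + 2 * m) + (1 + 3 * m) * 2) / 2              ≡⟨ +-distrib-/-∣ʳ (m * (k + 2 * m)) (n∣m*n (1 + 3 * m)) ⟩
  pentagonal m + (1 + 3 * m) * 2 / 2                   ≡⟨ ≡.cong (pentagonal m +_) (m*n/n≡m (1 + 3 * m) 2) ⟩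
  pentagonal m + (1 + 3 * m)                           ≡⟨ ℕ.+-comm (pentagonal m) _ ⟩
  1 + 3 * m + pentagonal m                             ∎
  where
  open ≡.≡-Reasoning
  lemma : ∀ k → (2 + k) * ((1 + k) + 2 * (2 + k)) ≡ (1 + k) * (k + 2 * (1 + k)) + (1 + 3 * (1 + k)) * 2
  lemma = solve-∀

qExponent : ℕ → ℕ → ℕ
qExponent m n = 3 * n * (3 * n + 2 * m) + m * (3 * m ∸ 1) / 2

-- The increment is a function of the weight only, which makes it constant on each level m + 2n = l.
qExponent-sucᵐ : ∀ m n → qExponent (suc m) n ≡ 1 + 3 * weight m n + qExponent m n
qExponent-sucᵐ m n = ≡.trans
  (≡.cong (3 * n * (3 * n + 2 * suc m) +_) (pentagonal-suc m)) (lemma m n (pentagonal m))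
  where
  lemma : ∀ m n p → 3 * n * (3 * n + 2 * (1 + m)) + (1 + 3 * m + p) ≡
                    1 + 3 * (m + 2 * n) + (3 * n * (3 * n + 2 * m) + p)
  lemma = solve-∀

-- 3 * m is moved to the left so that no subtraction occurs.
qExponent-sucⁿ : ∀ m n → 3 * m + qExponent m (suc n) ≡ 9 + 9 * weight m n + qExponent m n
qExponent-sucⁿ m n = lemma m n (pentagonal m)
  where
  lemma : ∀ m n p → 3 * m + (3 * (1 + n) * (3 * (1 + n) + 2 * m) + p) ≡
                    9 + 9 * (m + 2 * n) + (3 * n * (3 * n + 2 * m) + p)
  lemma = solve-∀

-- Makes the double series summable: a pair of weight above `N` contributes nothing to the
-- coefficient of q^N.
weight≤qExponent : ∀ m n → weight m n ≤ qExponent m n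
weight≤qExponent m n = ≡.subst (_≤ qExponent m n) (ℕ.+-comm (2 * n) m) (ℕ.+-mono-≤ (square n) (pent m))
  where
  square : ∀ n → 2 * n ≤ 3 * n * (3 * n + 2 * m)
  square zero    = z≤n
  square (suc n) = ℕ.≤-trans (ℕ.*-monoˡ-≤ (suc n) {2} {3} (s≤s (s≤s z≤n)))
    (ℕ.m≤m*n (3 * suc n) (3 * suc n + 2 * m))

  pent : ∀ m → m ≤ pentagonal m
  pent zero    = z≤n
  pent (suc m) = ≡.subst (suc m ≤_) (≡.sym (pentagonal-suc m))
    (s≤s (ℕ.≤-trans (ℕ.m≤m+n m (2 * m)) (ℕ.m≤m+n (3 * m) (pentagonal m))))

-- The recursive system, its uniqueness, and its solution by the double series.

module Levels (K : CommutativeSemiring 0ℓ 0ℓ) where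

  open CommutativeSemiring K renaming (_+_ to _+ᵏ_; _*_ to _*ᵏ_)
  open Exp semiring using (_^_; ^-homo-*; ^-congʳ)
  open CommutativeSemigroupProperties +-commutativeSemigroup using ()
    renaming (interchange to +-interchange)
  open SetoidReasoning setoid
  open SemiringSolver K using (solve; _:+_; _:*_; _:=_)

  -- Σ t m n over the m, n with m + 2n = l
  levelSum : (ℕ → ℕ → Carrier) → ℕ → Carrier
  levelSum t 0             = t 0 0
  levelSum t 1             = t 1 0
  levelSum t (suc (suc l)) = t (2 + l) 0 +ᵏ levelSum (λ m n → t m (suc n)) l

  -- The equation is asked for on the level only, so that powers with exponent in `weight m n` can
  -- be replaced by constants.
  levelSum-cong : ∀ {t u} l → (∀ m n → weight m n ≡ l → t m n ≈ u m n) → levelSum t l ≈ levelSum u l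
  levelSum-cong 0             e = e 0 0 ≡.refl
  levelSum-cong 1             e = e 1 0 ≡.refl
  levelSum-cong (suc (suc l)) e = +-cong (e (2 + l) 0 (ℕ.+-identityʳ (2 + l)))
    (levelSum-cong l λ m n w → e m (suc n) (≡.trans (weight-suc m n) (≡.cong (2 +_) w)))

  levelSum-+ : ∀ t u l → levelSum (λ m n → t m n +ᵏ u m n) l ≈ levelSum t l +ᵏ levelSum u l
  levelSum-+ t u 0             = refl
  levelSum-+ t u 1             = refl
  levelSum-+ t u (suc (suc l)) = trans
    (+-congˡ (levelSum-+ (λ m n → t m (suc n)) (λ m n → u m (suc n)) l)) (+-interchange _ _ _ _)

  levelSum-* : ∀ a t l → levelSum (λ m n → a *ᵏ t m n) l ≈ a *ᵏ levelSum t l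
  levelSum-* a t 0             = refl
  levelSum-* a t 1             = refl
  levelSum-* a t (suc (suc l)) = trans (+-congˡ (levelSum-* a (λ m n → t m (suc n)) l)) (sym (distribˡ a _ _))

  levelSum-^ : ∀ y t l → levelSum (λ m n → y ^ weight m n *ᵏ t m n) l ≈ y ^ l *ᵏ levelSum t l
  levelSum-^ y t l = trans (levelSum-cong l (λ m n w → *-congʳ (^-congʳ y w))) (levelSum-* (y ^ l) t l)

  -- The value `0#` stands for a term of index -1, so recurrences in m or n can be summed over a
  -- level without treating the boundary apart.
  shiftᵐ shiftⁿ : (ℕ → ℕ → Carrier) → ℕ → ℕ → Carrier
  shiftᵐ t zero    n = 0#
  shiftᵐ t (suc m) n = t m n
  shiftⁿ t m zero    = 0#
  shiftⁿ t m (suc n) = t m n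

  levelSum-shiftᵐ : ∀ t l → levelSum (shiftᵐ t) (suc l) ≈ levelSum t l
  levelSum-shiftᵐ t 0             = refl
  levelSum-shiftᵐ t 1             = +-identityʳ (t 1 0)
  levelSum-shiftᵐ t (suc (suc l)) = +-congˡ (trans
    (levelSum-cong (suc l) (λ { zero n _ → refl ; (suc m) n _ → refl }))
    (levelSum-shiftᵐ (λ m n → t m (suc n)) l))

  levelSum-shiftⁿ : ∀ t l → levelSum (shiftⁿ t) (2 + l) ≈ levelSum t l
  levelSum-shiftⁿ t l = +-identityˡ (levelSum t l)

  record System (q : Carrier) (A C B : ℕ → Carrier) : Set where
    field
      A-zero : A 0 ≈ 1#
      C-zero : C 0 ≈ 1#
      B-zero : B 0 ≈ 1#
      A-suc  : ∀ l → A (suc l) ≈ q ^ (1 + 3 * l) *ᵏ A l +ᵏ C (suc l)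
      C-suc  : ∀ l → C (suc l) ≈ q ^ (2 + 3 * l) *ᵏ C l +ᵏ B (suc l)
      B-suc  : ∀ l → B (suc l) ≈ q ^ (3 + 3 * l) *ᵏ A (suc l) +ᵏ q ^ (3 + 6 * l) *ᵏ A l

  -- The hypothesis expresses, without subtraction, that 1 - q^(k+1) can be cancelled. Chaining the
  -- three equations eliminates C (l+1) and B (l+1) and leaves a fixed-point equation for A (l+1)
  -- over A l and C l, so the induction carries A and C together, and B follows from A.
  System-unique : ∀ {q} →
    (∀ k {a b c} → a ≈ q ^ suc k *ᵏ a +ᵏ c → b ≈ q ^ suc k *ᵏ b +ᵏ c → a ≈ b) →
    ∀ {A C B A′ C′ B′} → System q A C B → System q A′ C′ B′ → ∀ l → A l ≈ A′ l
  System-unique {q} fix {A} {C} {B} {A′} {C′} {B′} 𝕊 𝕊′ l = proj₁ (both l)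
    where
    module 𝕊  = System 𝕊
    module 𝕊′ = System 𝕊′

    expand : ∀ {A C B} → System q A C B → ∀ l →
      A (suc l) ≈ q ^ (3 + 3 * l) *ᵏ A (suc l)
        +ᵏ (q ^ (1 + 3 * l) *ᵏ A l +ᵏ (q ^ (2 + 3 * l) *ᵏ C l +ᵏ q ^ (3 + 6 * l) *ᵏ A l))
    expand {A} {C} 𝕋 l = begin
      A (suc l)                                               ≈⟨ A-suc l ⟩
      a +ᵏ C (suc l)                                          ≈⟨ +-congˡ (C-suc l) ⟩
      a +ᵏ (c +ᵏ _)                                           ≈⟨ +-congˡ (+-congˡ (B-suc l)) ⟩
      a +ᵏ (c +ᵏ (b +ᵏ d))
        ≈⟨ solve 4 (λ a b c d → a :+ (c :+ (b :+ d)) := b :+ (a :+ (c :+ d))) refl a b c d ⟩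
      b +ᵏ (a +ᵏ (c +ᵏ d))                                    ∎
      where
      open System 𝕋
      a = q ^ (1 + 3 * l) *ᵏ A l
      c = q ^ (2 + 3 * l) *ᵏ C l
      b = q ^ (3 + 3 * l) *ᵏ A (suc l)
      d = q ^ (3 + 6 * l) *ᵏ A l

    both : ∀ l → A l ≈ A′ l × C l ≈ C′ l
    both zero    = trans 𝕊.A-zero (sym 𝕊′.A-zero) , trans 𝕊.C-zero (sym 𝕊′.C-zero)
    both (suc l) with a ← proj₁ (both l) | c ← proj₂ (both l) = a′ , (begin
      C (suc l)                               ≈⟨ 𝕊.C-suc l ⟩
      _ +ᵏ B (suc l)                          ≈⟨ +-cong (*-congˡ c) (𝕊.B-suc l) ⟩
      _                                       ≈⟨ +-congˡ (+-cong (*-congˡ a′) (*-congˡ a)) ⟩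
      _                                       ≈⟨ +-congˡ (𝕊′.B-suc l) ⟨
      _ +ᵏ B′ (suc l)                         ≈⟨ 𝕊′.C-suc l ⟨
      C′ (suc l)                              ∎)
      where
      a′ : A (suc l) ≈ A′ (suc l)
      a′ = fix (2 + 3 * l) (expand 𝕊 l)
        (trans (expand 𝕊′ l) (+-congˡ (sym (+-cong (*-congˡ a) (+-cong (*-congˡ c) (*-congˡ a))))))

  -- i m n stands for 1/((q;q)ₘ (q⁶;q⁶)ₙ) and s for -1.
  module DoubleSum
    (q s : Carrier) (1+s≈0 : 1# +ᵏ s ≈ 0#)
    (i : ℕ → ℕ → Carrier)
    (i-zero : i 0 0 ≈ 1#)
    (i-sucᵐ : ∀ m n → i (suc m) n ≈ i m n +ᵏ q ^ suc m *ᵏ i (suc m) n)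
    (i-sucⁿ : ∀ m n → i m (suc n) ≈ i m n +ᵏ q ^ (6 * suc n) *ᵏ i m (suc n))
    (E : ℕ → ℕ → ℕ)
    (E-zero : E 0 0 ≡ 0)
    (E-sucᵐ : ∀ m n → E (suc m) n ≡ 1 + 3 * weight m n + E m n)
    (E-sucⁿ : ∀ m n → 3 * m + E m (suc n) ≡ 9 + 9 * weight m n + E m n)
    where

    qTerm : ℕ → ℕ → Carrier
    qTerm m n = s ^ n *ᵏ (q ^ E m n *ᵏ i m n)

    L : ℕ → ℕ → Carrier
    L k = levelSum (λ m n → q ^ (k * m) *ᵏ qTerm m n)

    private
      ^-merge : ∀ a b c → a + b ≡ c → q ^ a *ᵏ q ^ b ≈ q ^ c
      ^-merge a b c e = trans (sym (^-homo-* q a b)) (^-congʳ q e)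

      ^-exchange : ∀ a b c d → a + b ≡ c + d → q ^ a *ᵏ q ^ b ≈ q ^ c *ᵏ q ^ d
      ^-exchange a b c d e = trans (^-merge a b (c + d) e) (^-homo-* q c d)

    -- This is (1 - q^(m+1)) qTerm (m+1) n = q^(1+3w) qTerm m n for w = m + 2n, with the subtraction
    -- moved to the right. The factor cancels against the last factor of (q;q)_(m+1); the power of q
    -- is the growth of `E`.
    qTerm-sucᵐ : ∀ m n → qTerm (suc m) n ≈
      q ^ (1 + 3 * weight m n) *ᵏ qTerm m n +ᵏ q ^ suc m *ᵏ qTerm (suc m) n
    qTerm-sucᵐ m n = begin
      s ^ n *ᵏ (e′ *ᵏ i (suc m) n)
        ≈⟨ *-congˡ (*-congˡ (i-sucᵐ m n)) ⟩
      s ^ n *ᵏ (e′ *ᵏ (i m n +ᵏ r *ᵏ i (suc m) n))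
        ≈⟨ solve 5 (λ s e a r b → s :* (e :* (a :+ r :* b)) := s :* (e :* a) :+ r :* (s :* (e :* b)))
             refl (s ^ n) e′ (i m n) r (i (suc m) n) ⟩
      s ^ n *ᵏ (e′ *ᵏ i m n) +ᵏ r *ᵏ qTerm (suc m) n
        ≈⟨ +-congʳ (*-congˡ (*-congʳ (sym (^-merge (1 + 3 * weight m n) (E m n) _ (≡.sym (E-sucᵐ m n)))))) ⟩
      s ^ n *ᵏ (u *ᵏ e *ᵏ i m n) +ᵏ r *ᵏ qTerm (suc m) n
        ≈⟨ +-congʳ (solve 4 (λ s u e a → s :* (u :* e :* a) := u :* (s :* (e :* a)))
             refl (s ^ n) u e (i m n)) ⟩
      u *ᵏ qTerm m n +ᵏ r *ᵏ qTerm (suc m) n ∎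
      where
      e  = q ^ E m n
      e′ = q ^ E (suc m) n
      r  = q ^ suc m
      u  = q ^ (1 + 3 * weight m n)

    -- Likewise 1 - q^(6(n+1)) cancels against a factor of the denominator. The extra q^(3m) makes
    -- both remaining exponents depend on the weight only: it completes the growth of `E`, and 3m +
    -- 6(n+1) is three times the weight.
    qTerm-sucⁿ : ∀ m n → q ^ (3 * m) *ᵏ qTerm m (suc n) ≈
      s *ᵏ q ^ (9 + 9 * weight m n) *ᵏ qTerm m n +ᵏ q ^ (3 * weight m (suc n)) *ᵏ qTerm m (suc n)
    qTerm-sucⁿ m n = begin
      v *ᵏ (s *ᵏ s ^ n *ᵏ (e′ *ᵏ i m (suc n)))
        ≈⟨ *-congˡ (*-congˡ (*-congˡ (i-sucⁿ m n))) ⟩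
      v *ᵏ (s *ᵏ s ^ n *ᵏ (e′ *ᵏ (i m n +ᵏ r *ᵏ i m (suc n))))
        ≈⟨ solve 7 (λ v s sⁿ e a r b → v :* (s :* sⁿ :* (e :* (a :+ r :* b))) :=
                      s :* (sⁿ :* (v :* e :* a)) :+ v :* r :* (s :* sⁿ :* (e :* b)))
             refl v s (s ^ n) e′ (i m n) r (i m (suc n)) ⟩
      s *ᵏ (s ^ n *ᵏ (v *ᵏ e′ *ᵏ i m n)) +ᵏ v *ᵏ r *ᵏ qTerm m (suc n)
        ≈⟨ +-cong
             (*-congˡ (*-congˡ (*-congʳ 
               (^-exchange (3 * m) (E m (suc n)) (9 + 9 * weight m n) (E m n) (E-sucⁿ m n)))))
             (*-congʳ (^-merge (3 * m) (6 * suc n) _ (exponent m n))) ⟩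
      s *ᵏ (s ^ n *ᵏ (u *ᵏ e *ᵏ i m n)) +ᵏ _
        ≈⟨ +-congʳ (solve 5 (λ s sⁿ u e a → s :* (sⁿ :* (u :* e :* a)) := s :* u :* (sⁿ :* (e :* a)))
             refl s (s ^ n) u e (i m n)) ⟩
      s *ᵏ u *ᵏ qTerm m n +ᵏ q ^ (3 * weight m (suc n)) *ᵏ qTerm m (suc n) ∎
      where
      v  = q ^ (3 * m)
      e  = q ^ E m n
      e′ = q ^ E m (suc n)
      r  = q ^ (6 * suc n)
      u  = q ^ (9 + 9 * weight m n)
      exponent : ∀ m n → 3 * m + 6 * suc n ≡ 3 * (m + 2 * suc n)
      exponent = solve-∀

    L-zero : ∀ k → L k 0 ≈ 1#
    L-zero k = begin
      q ^ (k * 0) *ᵏ (1# *ᵏ (q ^ E 0 0 *ᵏ i 0 0))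
        ≈⟨ *-cong (^-congʳ q (ℕ.*-zeroʳ k)) (trans (*-identityˡ _) (*-cong (^-congʳ q E-zero) i-zero)) ⟩
      1# *ᵏ (1# *ᵏ 1#)  ≈⟨ trans (*-identityˡ _) (*-identityˡ _) ⟩
      1#                ∎

    -- Multiply `qTerm-sucᵐ` by the power of q in `L k` and sum over level l + 1: the first summand
    -- drops to level l, and in the second the extra q^m raises k by one.
    L-suc : ∀ k l → L k (suc l) ≈ q ^ (1 + k + 3 * l) *ᵏ L k l +ᵏ L (suc k) (suc l)
    L-suc k l = begin
      L k (suc l)                        ≈⟨ levelSum-cong (suc l) (λ m n _ → split m n) ⟩
      levelSum (λ m n → shiftᵐ S m n +ᵏ q ^ (suc k * m) *ᵏ qTerm m n) (suc l)
                                         ≈⟨ levelSum-+ (shiftᵐ S) _ (suc l) ⟩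
      levelSum (shiftᵐ S) (suc l) +ᵏ _   ≈⟨ +-congʳ (levelSum-shiftᵐ S l) ⟩
      levelSum S l +ᵏ _
        ≈⟨ +-congʳ (levelSum-cong l (λ m n w → *-congʳ (^-congʳ q (≡.cong (λ w → 1 + k + 3 * w) w)))) ⟩
      levelSum (λ m n → q ^ (1 + k + 3 * l) *ᵏ (q ^ (k * m) *ᵏ qTerm m n)) l +ᵏ _
        ≈⟨ +-congʳ (levelSum-* (q ^ (1 + k + 3 * l)) _ l) ⟩
      q ^ (1 + k + 3 * l) *ᵏ L k l +ᵏ L (suc k) (suc l) ∎
      where
      S : ℕ → ℕ → Carrier
      S m n = q ^ (1 + k + 3 * weight m n) *ᵏ (q ^ (k * m) *ᵏ qTerm m n)

      exponent₁ : ∀ k m w → k * suc m + (1 + 3 * w) ≡ 1 + k + 3 * w + k * m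
      exponent₁ = solve-∀

      exponent₂ : ∀ k m → k * suc m + suc m ≡ suc k * suc m
      exponent₂ = solve-∀

      split : ∀ m n → q ^ (k * m) *ᵏ qTerm m n ≈ shiftᵐ S m n +ᵏ q ^ (suc k * m) *ᵏ qTerm m n
      -- For m = 0 the factor 1 - q^m vanishes, so there is no shifted term.
      split zero    n = trans (*-congʳ (^-congʳ q (≡.trans (ℕ.*-zeroʳ k) (≡.sym (ℕ.*-zeroʳ (suc k))))))
                              (sym (+-identityˡ _))
      split (suc m) n = begin
        a *ᵏ qTerm (suc m) n                                       ≈⟨ *-congˡ (qTerm-sucᵐ m n) ⟩
        a *ᵏ (u *ᵏ qTerm m n +ᵏ r *ᵏ qTerm (suc m) n)
          ≈⟨ solve 5 (λ a u t r t′ → a :* (u :* t :+ r :* t′) := a :* u :* t :+ a :* r :* t′)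
               refl a u (qTerm m n) r (qTerm (suc m) n) ⟩
        a *ᵏ u *ᵏ qTerm m n +ᵏ a *ᵏ r *ᵏ qTerm (suc m) n
          ≈⟨ +-cong
               (trans (*-congʳ (^-exchange (k * suc m) (1 + 3 * w) (1 + k + 3 * w) (k * m) (exponent₁ k m w)))
                      (*-assoc _ _ _))
               (*-congʳ (^-merge (k * suc m) (suc m) _ (exponent₂ k m))) ⟩
        S m n +ᵏ q ^ (suc k * suc m) *ᵏ qTerm (suc m) n            ∎
        where
        a = q ^ (k * suc m)
        w = weight m n
        u = q ^ (1 + 3 * w)
        r = q ^ suc m

    L₀≈ : ∀ l → L 0 l ≈ levelSum qTerm l
    L₀≈ l = levelSum-cong l (λ m n _ → *-identityˡ (qTerm m n))

    private
      S₃ : ℕ → ℕ → Carrier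
      S₃ m n = s *ᵏ q ^ (9 + 9 * weight m n) *ᵏ qTerm m n

      L₃ : ∀ l → L 3 l ≈ levelSum (shiftⁿ S₃) l +ᵏ q ^ (3 * l) *ᵏ L 0 l
      L₃ l = begin
        L 3 l ≈⟨ levelSum-cong l split ⟩
        levelSum (λ m n → shiftⁿ S₃ m n +ᵏ q ^ (3 * l) *ᵏ qTerm m n) l
          ≈⟨ levelSum-+ (shiftⁿ S₃) _ l ⟩
        _ +ᵏ levelSum (λ m n → q ^ (3 * l) *ᵏ qTerm m n) l
          ≈⟨ +-congˡ (levelSum-* (q ^ (3 * l)) qTerm l) ⟩
        _ +ᵏ q ^ (3 * l) *ᵏ levelSum qTerm l                           ≈⟨ +-congˡ (*-congˡ (L₀≈ l)) ⟨
        _ +ᵏ q ^ (3 * l) *ᵏ L 0 l                                  ∎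
        where
        split : ∀ m n → weight m n ≡ l → q ^ (3 * m) *ᵏ qTerm m n ≈ shiftⁿ S₃ m n +ᵏ q ^ (3 * l) *ᵏ qTerm m n
        -- Without n the level is m itself, and q^(3m) is already q^(3l).
        split m zero    ≡.refl = trans (*-congʳ (^-congʳ q (≡.cong (3 *_) (≡.sym (ℕ.+-identityʳ m)))))
                                       (sym (+-identityˡ _))
        split m (suc n) ≡.refl = qTerm-sucⁿ m n

    L₃-one : L 3 1 ≈ q ^ 3 *ᵏ L 0 1
    L₃-one = trans (L₃ 1) (+-identityˡ _)

    L₃-suc-suc : ∀ l → L 3 (2 + l) ≈
      s *ᵏ q ^ (9 + 9 * l) *ᵏ L 0 l +ᵏ q ^ (3 * (2 + l)) *ᵏ L 0 (2 + l)
    L₃-suc-suc l = trans (L₃ (2 + l)) (+-congʳ (begin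
      levelSum (shiftⁿ S₃) (2 + l)                             ≈⟨ levelSum-shiftⁿ S₃ l ⟩
      levelSum S₃ l
        ≈⟨ levelSum-cong l (λ m n w → *-congʳ (*-congˡ (^-congʳ q (≡.cong (λ w → 9 + 9 * w) w)))) ⟩
      levelSum (λ m n → s *ᵏ q ^ (9 + 9 * l) *ᵏ qTerm m n) l       ≈⟨ levelSum-* _ qTerm l ⟩
      s *ᵏ q ^ (9 + 9 * l) *ᵏ levelSum qTerm l                     ≈⟨ *-congˡ (L₀≈ l) ⟨
      s *ᵏ q ^ (9 + 9 * l) *ᵏ L 0 l                            ∎))

    -- Apply `L-suc` with k = 2, then the induction hypothesis to L 2 (l+1) and `L₃-suc-suc` to L 3
    -- (l+2). Both produce L 0 l with exponent 9 + 9l, once with the factor `s`, so these cancel.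
    -- Level 1 contains no pair with n > 0, hence nothing to cancel in the base case.
    L₂-suc : ∀ l → L 2 (suc l) ≈ q ^ (3 + 3 * l) *ᵏ L 0 (suc l) +ᵏ q ^ (3 + 6 * l) *ᵏ L 0 l
    L₂-suc zero = begin
      L 2 1                             ≈⟨ L-suc 2 0 ⟩
      q ^ 3 *ᵏ L 2 0 +ᵏ L 3 1           ≈⟨ +-cong (*-congˡ (trans (L-zero 2) (sym (L-zero 0)))) L₃-one ⟩
      q ^ 3 *ᵏ L 0 0 +ᵏ q ^ 3 *ᵏ L 0 1  ≈⟨ +-comm _ _ ⟩
      q ^ 3 *ᵏ L 0 1 +ᵏ q ^ 3 *ᵏ L 0 0  ∎
    L₂-suc (suc l) = begin
      L 2 (2 + l)                                              ≈⟨ L-suc 2 (suc l) ⟩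
      a *ᵏ L 2 (suc l) +ᵏ L 3 (2 + l)                          ≈⟨ +-cong (*-congˡ (L₂-suc l)) (L₃-suc-suc l) ⟩
      a *ᵏ (b *ᵏ x₁ +ᵏ c *ᵏ x₀) +ᵏ (s *ᵏ d *ᵏ x₀ +ᵏ e *ᵏ x₂)
        ≈⟨ solve 9 (λ a b c d e s x₀ x₁ x₂ → a :* (b :* x₁ :+ c :* x₀) :+ (s :* d :* x₀ :+ e :* x₂) :=
                     a :* b :* x₁ :+ a :* c :* x₀ :+ (s :* (d :* x₀) :+ e :* x₂))
             refl a b c d e s x₀ x₁ x₂ ⟩
      a *ᵏ b *ᵏ x₁ +ᵏ a *ᵏ c *ᵏ x₀ +ᵏ (s *ᵏ (d *ᵏ x₀) +ᵏ e *ᵏ x₂)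
        ≈⟨ +-cong (+-cong (*-congʳ (^-merge (3 + 3 * suc l) (3 + 3 * l) _ (exponent₁ l)))
                          (*-congʳ (^-merge (3 + 3 * suc l) (3 + 6 * l) _ (exponent₂ l))))
                  (+-congˡ (*-congʳ (^-congʳ q (exponent₃ l)))) ⟩
      f *ᵏ x₁ +ᵏ d *ᵏ x₀ +ᵏ (s *ᵏ (d *ᵏ x₀) +ᵏ a *ᵏ x₂)
        ≈⟨ solve 4 (λ f y s z → f :+ y :+ (s :* y :+ z) := z :+ (f :+ (y :+ s :* y)))
             refl (f *ᵏ x₁) (d *ᵏ x₀) s (a *ᵏ x₂) ⟩
      a *ᵏ x₂ +ᵏ (f *ᵏ x₁ +ᵏ (d *ᵏ x₀ +ᵏ s *ᵏ (d *ᵏ x₀)))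
        ≈⟨ +-congˡ (trans (+-congˡ (cancel (d *ᵏ x₀))) (+-identityʳ _)) ⟩
      a *ᵏ x₂ +ᵏ f *ᵏ x₁ ∎
      where
      a = q ^ (3 + 3 * suc l)
      b = q ^ (3 + 3 * l)
      c = q ^ (3 + 6 * l)
      d = q ^ (9 + 9 * l)
      e = q ^ (3 * (2 + l))
      f = q ^ (3 + 6 * suc l)
      x₀ = L 0 l
      x₁ = L 0 (suc l)
      x₂ = L 0 (2 + l)

      cancel : ∀ y → y +ᵏ s *ᵏ y ≈ 0#
      cancel y = trans (+-congʳ (sym (*-identityˡ y)))
        (trans (sym (distribʳ y 1# s)) (trans (*-congʳ 1+s≈0) (zeroˡ y)))

      exponent₁ : ∀ l → 3 + 3 * suc l + (3 + 3 * l) ≡ 3 + 6 * suc l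
      exponent₁ = solve-∀
      exponent₂ : ∀ l → 3 + 3 * suc l + (3 + 6 * l) ≡ 9 + 9 * l
      exponent₂ = solve-∀
      exponent₃ : ∀ l → 3 * (2 + l) ≡ 3 + 3 * suc l
      exponent₃ = solve-∀

    system : System q (L 0) (L 1) (L 2)
    system = record
      { A-zero = L-zero 0 ; C-zero = L-zero 1 ; B-zero = L-zero 2
      ; A-suc = L-suc 0 ; C-suc = L-suc 1 ; B-suc = L₂-suc }

-- Schur partitions counted by bounds on their smallest and largest parts.

module Counting (K : CommutativeSemiring 0ℓ 0ℓ) (q : CommutativeSemiring.Carrier K) where

  open CommutativeSemiring K renaming (_+_ to _+ᵏ_; _*_ to _*ᵏ_)
  open Exp semiring using (_^_; ^-homo-*; ^-congʳ)
  open SetoidReasoning setoid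
  open SemiringSolver K using (solve; _:+_; _:*_; _:=_)

  -- D d M l enumerates by size the Schur partitions into l parts, all > d and ≤ M.
  -- The recursion removes the largest part, as a composition is built from its first part.
  D : ℕ → ℕ → ℕ → Carrier
  D d M       zero    = 1#
  D d zero    (suc l) = 0#
  D d (suc M) (suc l) = D d M (suc l) +ᵏ (if d ≤ᵇ M then q ^ suc M *ᵏ D d (maxNext M) l else 0#)

  D-above : ∀ {d M} l → d ≤ M → D d (suc M) (suc l) ≈ D d M (suc l) +ᵏ q ^ suc M *ᵏ D d (maxNext M) l
  D-above {d} {M} l d≤M with d ≤ᵇ M in eq
  ... | true  = refl
  ... | false = contradiction (≡.subst T eq (ℕ.≤⇒≤ᵇ d≤M)) λ ()

  D-below : ∀ {d} M l → M ≤ d → D d M (suc l) ≈ 0#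
  D-below     zero    l M≤d = refl
  D-below {d} (suc M) l M<d with d ≤ᵇ M in eq
  ... | true  = contradiction (ℕ.≤ᵇ⇒≤ d M (≡.subst T (≡.sym eq) _)) (ℕ.<⇒≱ M<d)
  ... | false = trans (+-identityʳ _) (D-below M l (ℕ.<⇒≤ M<d))

  module _ {d e : ℕ} (θ : Threshold d e) (d<e : d < e) where

    -- Either d + 1 does not occur, or it is the smallest part and, by the threshold, all other
    -- parts exceed e. Since `D` removes largest parts, this is proved by induction along that
    -- recursion: removing a largest part commutes with removing the smallest.
    D-split : ∀ l M → d < M → D d M (suc l) ≈ D (suc d) M (suc l) +ᵏ q ^ suc d *ᵏ D e M l
    D-split l (suc M) (s≤s d≤M) with ℕ.m≤n⇒m<n∨m≡n d≤M
    -- The bound is d + 1, the only part allowed; by `none`, both remainders count just the empty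
    -- partition.
    ... | inj₂ ≡.refl = begin
      D d (suc d) (suc l)                            ≈⟨ D-above l ℕ.≤-refl ⟩
      D d d (suc l) +ᵏ q ^ suc d *ᵏ D d (maxNext d) l  ≈⟨ +-cong (D-below d l ℕ.≤-refl) (*-congˡ (none l)) ⟩
      0# +ᵏ q ^ suc d *ᵏ D e (suc d) l               ≈⟨ +-congʳ (D-below (suc d) l ℕ.≤-refl) ⟨
      D (suc d) (suc d) (suc l) +ᵏ _                 ∎
      where
      none : ∀ l → D d (maxNext d) l ≈ D e (suc d) l
      none zero    = refl
      none (suc l) = trans (D-below (maxNext d) l (maxNext≤ d)) (sym (D-below (suc d) l d<e))
    ... | inj₁ d<M = begin
      D d (suc M) (suc l)                    ≈⟨ D-above l d≤M ⟩
      D d M (suc l) +ᵏ Q *ᵏ D d g l          ≈⟨ +-congʳ (D-split l M d<M) ⟩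
      D (suc d) M (suc l) +ᵏ r *ᵏ D e M l +ᵏ Q *ᵏ D d g l
                                             ≈⟨ +-assoc _ _ _ ⟩
      D (suc d) M (suc l) +ᵏ (r *ᵏ D e M l +ᵏ Q *ᵏ D d g l)
                                             ≈⟨ +-congˡ (exchange l) ⟩
      D (suc d) M (suc l) +ᵏ (Q *ᵏ D (suc d) g l +ᵏ r *ᵏ D e (suc M) l)
                                             ≈⟨ +-assoc _ _ _ ⟨
      D (suc d) M (suc l) +ᵏ Q *ᵏ D (suc d) g l +ᵏ r *ᵏ D e (suc M) l
                                             ≈⟨ +-congʳ (D-above l d<M) ⟨
      D (suc d) (suc M) (suc l) +ᵏ r *ᵏ D e (suc M) l ∎
      where
      g = maxNext M
      Q = q ^ suc M
      r = q ^ suc d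

      exchange : ∀ l → r *ᵏ D e M l +ᵏ Q *ᵏ D d g l ≈ Q *ᵏ D (suc d) g l +ᵏ r *ᵏ D e (suc M) l
      -- A single part is both largest and smallest: every `D` is `1#`, and the two powers of q
      -- swap.
      exchange zero    = +-comm _ _
      exchange (suc l) with θ M
      ... | inj₁ (e≤M , d<g) = begin
        r *ᵏ D e M (suc l) +ᵏ Q *ᵏ D d g (suc l)
          ≈⟨ +-congˡ (*-congˡ (D-split l g d<g)) ⟩
        r *ᵏ D e M (suc l) +ᵏ Q *ᵏ (D (suc d) g (suc l) +ᵏ r *ᵏ D e g l)
          ≈⟨ solve 5 (λ r a Q b c → r :* a :+ Q :* (b :+ r :* c) := Q :* b :+ r :* (a :+ Q :* c))
               refl r (D e M (suc l)) Q (D (suc d) g (suc l)) (D e g l) ⟩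
        Q *ᵏ D (suc d) g (suc l) +ᵏ r *ᵏ (D e M (suc l) +ᵏ Q *ᵏ D e g l)
          ≈⟨ +-congˡ (*-congˡ (D-above l e≤M)) ⟨
        Q *ᵏ D (suc d) g (suc l) +ᵏ r *ᵏ D e (suc M) (suc l) ∎
      -- All four counts vanish: no part > d can follow 1 + M, and no part up to 1 + M exceeds e.
      ... | inj₂ (M<e , g≤d) = trans
        (+-cong (*-congˡ (trans (D-below M l (ℕ.<⇒≤ M<e)) (sym (D-below (suc M) l M<e))))
                (*-congˡ (trans (D-below g l g≤d) (sym (D-below g l (ℕ.m≤n⇒m≤1+n g≤d))))))
        (+-comm _ _)

  -- Subtracting 3 from each of the l parts keeps all gaps and all residues modulo 3, and lowers the
  -- size by 3l.
  D-shift : ∀ d M l → D (3 + d) (3 + M) l ≈ q ^ (3 * l) *ᵏ D d M l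
  D-shift d M       zero    = sym (*-identityˡ 1#)
  D-shift d zero    (suc l) = trans (D-below 3 l (ℕ.m≤m+n 3 d)) (sym (zeroʳ _))
  D-shift d (suc M) (suc l) with d ℕ.≤? M | D-shift d M (suc l) | D-shift d (maxNext M) l
  ... | no d≰M  | _ | _ = trans (D-below (4 + M) l (s≤s (s≤s (s≤s (ℕ.≰⇒> d≰M)))))
    (sym (trans (*-congˡ (D-below (suc M) l (ℕ.≰⇒> d≰M))) (zeroʳ _)))
  ... | yes d≤M | sameBound | nextBound = begin
    D (3 + d) (4 + M) (suc l)
      ≈⟨ D-above l (s≤s (s≤s (s≤s d≤M))) ⟩
    D (3 + d) (3 + M) (suc l) +ᵏ q ^ (4 + M) *ᵏ D (3 + d) (maxNext (3 + M)) l
      ≈⟨ +-cong sameBound (*-congˡ (trans (next M l) nextBound)) ⟩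
    q ^ (3 * suc l) *ᵏ D d M (suc l) +ᵏ q ^ (4 + M) *ᵏ (q ^ (3 * l) *ᵏ D d (maxNext M) l)
      ≈⟨ +-congˡ (trans (sym (*-assoc _ _ _)) (trans (*-congʳ exponents) (*-assoc _ _ _))) ⟩
    q ^ (3 * suc l) *ᵏ D d M (suc l) +ᵏ q ^ (3 * suc l) *ᵏ (q ^ suc M *ᵏ D d (maxNext M) l)
      ≈⟨ distribˡ _ _ _ ⟨
    q ^ (3 * suc l) *ᵏ (D d M (suc l) +ᵏ q ^ suc M *ᵏ D d (maxNext M) l)
      ≈⟨ *-congˡ (D-above l d≤M) ⟨
    q ^ (3 * suc l) *ᵏ D d (suc M) (suc l) ∎
    where
    exponent : ∀ M l → 4 + M + 3 * l ≡ 3 * suc l + suc M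
    exponent = solve-∀

    exponents : q ^ (4 + M) *ᵏ q ^ (3 * l) ≈ q ^ (3 * suc l) *ᵏ q ^ suc M
    exponents = trans (sym (^-homo-* q (4 + M) (3 * l)))
      (trans (^-congʳ q (exponent M l)) (^-homo-* q (3 * suc l) (suc M)))

    below : ∀ {a} l → a ≤ 3 → D (3 + d) a l ≈ D (3 + d) 3 l
    below zero    a≤3 = refl
    below (suc l) a≤3 = trans (D-below _ l (ℕ.≤-trans a≤3 (ℕ.m≤m+n 3 d)))
                              (sym (D-below 3 l (ℕ.m≤m+n 3 d)))

    -- The two bounds differ for M < 3, but then both are at most 3 and admit no part > 3 + d.
    next : ∀ M l → D (3 + d) (maxNext (3 + M)) l ≈ D (3 + d) (3 + maxNext M) l
    next 0 l = below l (s≤s z≤n)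
    next 1 l = below l (s≤s (s≤s z≤n))
    next 2 l = below l (s≤s (s≤s z≤n))
    next (suc (suc (suc M))) l = refl

  open Levels K using (System)

  -- Splits off the parts 1, 2, 3 with the thresholds 3, 4, 6. Shifting by 3 leads from the bounds 3
  -- and 4 back to 0 and 1; the bound 6 takes two shifts, whence the exponent 6l.
  D∞-system : (D∞ : ℕ → ℕ → Carrier) →
    (∀ d → D∞ d 0 ≈ 1#) →
    (∀ {d e} → Threshold d e → d < e → ∀ l → D∞ d (suc l) ≈ D∞ (suc d) (suc l) +ᵏ q ^ suc d *ᵏ D∞ e l) →
    (∀ d l → D∞ (3 + d) l ≈ q ^ (3 * l) *ᵏ D∞ d l) →
    System q (D∞ 0) (D∞ 1) (D∞ 2)
  D∞-system D∞ D∞-zero D∞-split D∞-shift = record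
    { A-zero = D∞-zero 0
    ; C-zero = D∞-zero 1
    ; B-zero = D∞-zero 2
    ; A-suc  = λ l → trans (D∞-split threshold-0-3 (s≤s z≤n) l) (trans (+-comm _ _)
        (+-congʳ (trans (*-congˡ (D∞-shift 0 l)) (^-merge-* 1 (3 * l) (1 + 3 * l) _ ≡.refl))))
    ; C-suc  = λ l → trans (D∞-split threshold-1-4 (s≤s (s≤s z≤n)) l) (trans (+-comm _ _)
        (+-congʳ (trans (*-congˡ (D∞-shift 1 l)) (^-merge-* 2 (3 * l) (2 + 3 * l) _ ≡.refl))))
    ; B-suc  = λ l → trans (D∞-split threshold-2-6 (s≤s (s≤s (s≤s z≤n))) l) (+-cong
        (trans (D∞-shift 0 (suc l)) (*-congʳ (^-congʳ q (ℕ.*-suc 3 l))))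
        (trans (*-congˡ (trans (D∞-shift 3 l) (trans (*-congˡ (D∞-shift 0 l))
                                               (^-merge-* (3 * l) (3 * l) (6 * l) _ (double l)))))
               (^-merge-* 3 (6 * l) (3 + 6 * l) _ ≡.refl)))
    }
    where
    double : ∀ l → 3 * l + 3 * l ≡ 6 * l
    double = solve-∀

    ^-merge-* : ∀ a b c y → a + b ≡ c → q ^ a *ᵏ (q ^ b *ᵏ y) ≈ q ^ c *ᵏ y
    ^-merge-* a b c y e = trans (sym (*-assoc _ _ _))
      (*-congʳ (trans (sym (^-homo-* q a b)) (^-congʳ q e)))

  total : (ℕ → Carrier) → ℕ → Carrier
  total u zero    = u 0
  total u (suc n) = total u n +ᵏ u (suc n)

  total-cong : ∀ {u v} → (∀ l → u l ≈ v l) → ∀ n → total u n ≈ total v n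
  total-cong e zero    = e 0
  total-cong e (suc n) = +-cong (total-cong e n) (e (suc n))

  total-front : ∀ u n → total u (suc n) ≈ u 0 +ᵏ total (λ l → u (suc l)) n
  total-front u zero    = refl
  total-front u (suc n) = trans (+-congʳ (total-front u n)) (+-assoc _ _ _)

  total-+ : ∀ u v n → total (λ l → u l +ᵏ v l) n ≈ total u n +ᵏ total v n
  total-+ u v zero    = refl
  total-+ u v (suc n) = trans (+-congʳ (total-+ u v n))
    (solve 4 (λ a b c d → (a :+ b) :+ (c :+ d) := (a :+ c) :+ (b :+ d)) refl _ _ _ _)

  total-* : ∀ a u n → total (λ l → a *ᵏ u l) n ≈ a *ᵏ total u n
  total-* a u zero    = refl
  total-* a u (suc n) = trans (+-congʳ (total-* a u n)) (sym (distribˡ a _ _))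

  -- The parts are distinct, so at most M of them fit below the bound M, and summing over l ≤ n is
  -- complete when M ≤ n. In the induction, removing the largest part lowers n by one, and the new
  -- bound `maxNext M` still fits.
  total-D : ∀ (x : Carrier) (Φ : ℕ → Carrier) → Φ 0 ≈ 1# →
    (∀ M → Φ (suc M) ≈ Φ M +ᵏ q ^ suc M *ᵏ (x *ᵏ Φ (maxNext M))) →
    ∀ n M → M ≤ n → Φ M ≈ total (λ l → x ^ l *ᵏ D 0 M l) n
  total-D x Φ Φ-zero Φ-suc = go
    where
    term : ℕ → ℕ → Carrier
    term M l = x ^ l *ᵏ D 0 M l

    go : ∀ n M → M ≤ n → Φ M ≈ total (term M) n
    go zero    zero    _ = trans Φ-zero (sym (*-identityˡ 1#))
    go (suc n) zero    _ = begin
      Φ 0                                      ≈⟨ go n 0 z≤n ⟩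
      total (term 0) n                         ≈⟨ +-identityʳ _ ⟨
      total (term 0) n +ᵏ 0#                   ≈⟨ +-congˡ (zeroʳ _) ⟨
      total (term 0) (suc n)                   ∎
    go (suc n) (suc M) (s≤s M≤n) = begin
      Φ (suc M)
        ≈⟨ Φ-suc M ⟩
      Φ M +ᵏ Q *ᵏ (x *ᵏ Φ g)
        ≈⟨ +-cong (go (suc n) M (ℕ.m≤n⇒m≤1+n M≤n)) (*-congˡ (*-congˡ (go n g (ℕ.≤-trans (maxNext≤ M) M≤n)))) ⟩
      total (term M) (suc n) +ᵏ Q *ᵏ (x *ᵏ total (term g) n)
        ≈⟨ +-cong (total-front (term M) n)
             (trans (*-congˡ (sym (total-* x (term g) n))) (sym (total-* Q (λ l → x *ᵏ term g l) n))) ⟩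
      term M 0 +ᵏ total (λ l → term M (suc l)) n +ᵏ total (λ l → Q *ᵏ (x *ᵏ term g l)) n
        ≈⟨ +-assoc _ _ _ ⟩
      term M 0 +ᵏ (total (λ l → term M (suc l)) n +ᵏ total (λ l → Q *ᵏ (x *ᵏ term g l)) n)
        ≈⟨ +-congˡ (total-+ (λ l → term M (suc l)) (λ l → Q *ᵏ (x *ᵏ term g l)) n) ⟨
      term (suc M) 0 +ᵏ total (λ l → term M (suc l) +ᵏ Q *ᵏ (x *ᵏ term g l)) n
        ≈⟨ +-congˡ (total-cong (λ l →
             solve 5 (λ x xˡ a Q b → x :* xˡ :* a :+ Q :* (x :* (xˡ :* b)) := x :* xˡ :* (a :+ Q :* b))
               refl x (x ^ l) (D 0 M (suc l)) Q (D 0 g l)) n) ⟩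
      term (suc M) 0 +ᵏ total (λ l → term (suc M) (suc l)) n
        ≈⟨ total-front (term (suc M)) n ⟨
      total (term (suc M)) (suc n) ∎
      where
      g = maxNext M
      Q = q ^ suc M

-- Inverses in a commutative ring.

module Inverses (R : CommutativeRing 0ℓ 0ℓ) where

  open CommutativeRing R renaming (_+_ to _+ᵣ_; _*_ to _*ᵣ_)
  open RingProperties ring using (+-cancelʳ)
  open SetoidReasoning setoid
  open SemiringSolver commutativeSemiring using (solve; _:+_; _:*_; _:=_)

  1-f+f≈1 : ∀ f → 1# +ᵣ (- f) +ᵣ f ≈ 1#
  1-f+f≈1 f = trans (+-assoc 1# (- f) f) (trans (+-congˡ (-‿inverseˡ f)) (+-identityʳ 1#))

  -- Both sides become i when (1 - f) i is added. The hypothesis is the equation satisfied by the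
  -- geometric series in 1 - f.
  fixpoint⇒inverse : ∀ f i → i ≈ 1# +ᵣ (1# +ᵣ (- f)) *ᵣ i → f *ᵣ i ≈ 1#
  fixpoint⇒inverse f i e = +-cancelʳ (g *ᵣ i) (f *ᵣ i) 1# (begin
    f *ᵣ i +ᵣ g *ᵣ i         ≈⟨ +-comm _ _ ⟩
    g *ᵣ i +ᵣ f *ᵣ i         ≈⟨ distribʳ i g f ⟨
    (g +ᵣ f) *ᵣ i           ≈⟨ *-congʳ (1-f+f≈1 f) ⟩
    1# *ᵣ i                 ≈⟨ *-identityˡ i ⟩
    i                      ≈⟨ e ⟩
    1# +ᵣ g *ᵣ i            ∎)
    where
    g : Carrier
    g = 1# +ᵣ (- f)

  -- Inserting f′ i′ = 1 gives i = i f (1 - t) i′ = (1 - t) i′.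
  inverse-*-1-t : ∀ {f f′ i i′} t → f *ᵣ i ≈ 1# → f′ *ᵣ i′ ≈ 1# →
    f′ ≈ f *ᵣ (1# +ᵣ (- t)) → i′ ≈ i +ᵣ t *ᵣ i′
  inverse-*-1-t {f} {f′} {i} {i′} t fi f′i′ e = sym (begin
    i +ᵣ t *ᵣ i′
      ≈⟨ +-congʳ (trans (sym (*-identityʳ i)) (*-congˡ (trans (sym f′i′) (*-congʳ e)))) ⟩
    i *ᵣ (f *ᵣ u *ᵣ i′) +ᵣ t *ᵣ i′  ≈⟨ solve 5 (λ f i u i′ t → i :* (f :* u :* i′) :+ t :* i′ :=
                                              f :* i :* (u :* i′) :+ t :* i′) refl f i u i′ t ⟩
    f *ᵣ i *ᵣ (u *ᵣ i′) +ᵣ t *ᵣ i′  ≈⟨ +-congʳ (trans (*-congʳ fi) (*-identityˡ _)) ⟩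
    u *ᵣ i′ +ᵣ t *ᵣ i′            ≈⟨ distribʳ i′ u t ⟨
    (u +ᵣ t) *ᵣ i′               ≈⟨ *-congʳ (1-f+f≈1 t) ⟩
    1# *ᵣ i′                     ≈⟨ *-identityˡ i′ ⟩
    i′                          ∎)
    where
    u : Carrier
    u = 1# +ᵣ (- t)

-- Formal power series over a commutative ring.

module PowerSeries (R : CommutativeRing 0ℓ 0ℓ) where

  open CommutativeRing R renaming (_+_ to _+ᵣ_; _*_ to _*ᵣ_)
  open RawRing (rawRing ⟦q⟧) public using ()
    renaming ( Carrier to Seq; _≈_ to _≈∞_; _+_ to _+∞_; _*_ to _*∞_
             ; -_ to -∞_; 0# to 0∞; 1# to 1∞ )
  open SetoidReasoning setoid

  -- By definition `(f *∞ g) (suc n)` unfolds to `f 0 *ᵣ g (suc n) +ᵣ (tail f *∞ g) n`, so the ring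
  -- laws are proved by induction on the coefficient, for all series at once.
  tail : Seq → Seq
  tail f n = f (suc n)

  *∞-zero : ∀ f g → (f *∞ g) 0 ≈ f 0 *ᵣ g 0
  *∞-zero f g = +-identityʳ (f 0 *ᵣ g 0)

  *∞-cong-≤ : ∀ n {f f′ g g′} → (∀ i → i ≤ n → f i ≈ f′ i) →
              (∀ i → i ≤ n → g i ≈ g′ i) → (f *∞ g) n ≈ (f′ *∞ g′) n
  *∞-cong-≤ zero    f≈ g≈ = +-congʳ (*-cong (f≈ 0 z≤n) (g≈ 0 z≤n))
  *∞-cong-≤ (suc n) f≈ g≈ = +-cong
    (*-cong (f≈ 0 z≤n) (g≈ (suc n) ℕ.≤-refl))
    (*∞-cong-≤ n (λ i i≤n → f≈ (suc i) (s≤s i≤n)) (λ i i≤n → g≈ i (ℕ.m≤n⇒m≤1+n i≤n)))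

  *∞-cong : ∀ {f f′ g g′} → f ≈∞ f′ → g ≈∞ g′ → f *∞ g ≈∞ f′ *∞ g′
  *∞-cong f≈ g≈ n = *∞-cong-≤ n (λ i _ → f≈ i) (λ i _ → g≈ i)

  private
    interchange : ∀ a b c d → (a +ᵣ b) +ᵣ (c +ᵣ d) ≈ (a +ᵣ c) +ᵣ (b +ᵣ d)
    interchange = solve 4 (λ a b c d → (a :+ b) :+ (c :+ d) := (a :+ c) :+ (b :+ d)) refl
      where open SemiringSolver commutativeSemiring

  *∞-distribʳ : ∀ h f g → (f +∞ g) *∞ h ≈∞ (f *∞ h) +∞ (g *∞ h)
  *∞-distribʳ h f g zero    = trans (+-congʳ (distribʳ (h 0) (f 0) (g 0)))
    (trans (+-congˡ (sym (+-identityʳ 0#))) (interchange _ _ _ _))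
  *∞-distribʳ h f g (suc n) = trans
    (+-cong (distribʳ (h (suc n)) (f 0) (g 0)) (*∞-distribʳ h (tail f) (tail g) n))
    (interchange _ _ _ _)

  *∞-scale : ∀ a f g n → ((λ i → a *ᵣ f i) *∞ g) n ≈ a *ᵣ (f *∞ g) n
  *∞-scale a f g zero    = trans (+-cong (*-assoc a (f 0) (g 0)) (sym (zeroʳ a))) (sym (distribˡ a _ _))
  *∞-scale a f g (suc n) = trans
    (+-cong (*-assoc a (f 0) (g (suc n))) (*∞-scale a (tail f) g n)) (sym (distribˡ a _ _))

  *∞-assoc : ∀ f g h → (f *∞ g) *∞ h ≈∞ f *∞ (g *∞ h)
  *∞-assoc f g h zero = +-congʳ (begin
    (f *∞ g) 0 *ᵣ h 0       ≈⟨ *-congʳ (*∞-zero f g) ⟩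
    f 0 *ᵣ g 0 *ᵣ h 0        ≈⟨ *-assoc (f 0) (g 0) (h 0) ⟩
    f 0 *ᵣ (g 0 *ᵣ h 0)      ≈⟨ *-congˡ (*∞-zero g h) ⟨
    f 0 *ᵣ (g *∞ h) 0       ∎)
  *∞-assoc f g h (suc n) = begin
    (f *∞ g) 0 *ᵣ h (suc n) +ᵣ (((λ i → f 0 *ᵣ tail g i) +∞ (tail f *∞ g)) *∞ h) n
      ≈⟨ +-cong (*-congʳ (*∞-zero f g)) (*∞-distribʳ h (λ i → f 0 *ᵣ tail g i) (tail f *∞ g) n) ⟩
    f 0 *ᵣ g 0 *ᵣ h (suc n) +ᵣ (((λ i → f 0 *ᵣ tail g i) *∞ h) n +ᵣ ((tail f *∞ g) *∞ h) n)
      ≈⟨ +-cong (*-assoc (f 0) (g 0) (h (suc n)))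
                (+-cong (*∞-scale (f 0) (tail g) h n) (*∞-assoc (tail f) g h n)) ⟩
    f 0 *ᵣ (g 0 *ᵣ h (suc n)) +ᵣ (f 0 *ᵣ (tail g *∞ h) n +ᵣ (tail f *∞ (g *∞ h)) n)
      ≈⟨ +-assoc _ _ _ ⟨
    f 0 *ᵣ (g 0 *ᵣ h (suc n)) +ᵣ f 0 *ᵣ (tail g *∞ h) n +ᵣ (tail f *∞ (g *∞ h)) n
      ≈⟨ +-congʳ (distribˡ (f 0) _ _) ⟨
    f 0 *ᵣ (g *∞ h) (suc n) +ᵣ (tail f *∞ (g *∞ h)) n ∎

  -- Splits off the last summand of the convolution where the definition splits off the first;
  -- comparing the two expansions gives commutativity.
  *∞-sucʳ : ∀ f g n → (f *∞ g) (suc n) ≈ f (suc n) *ᵣ g 0 +ᵣ (f *∞ tail g) n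
  *∞-sucʳ f g zero    = begin
    f 0 *ᵣ g 1 +ᵣ (f 1 *ᵣ g 0 +ᵣ 0#)   ≈⟨ +-congˡ (+-identityʳ _) ⟩
    f 0 *ᵣ g 1 +ᵣ f 1 *ᵣ g 0           ≈⟨ +-comm _ _ ⟩
    f 1 *ᵣ g 0 +ᵣ f 0 *ᵣ g 1           ≈⟨ +-congˡ (+-identityʳ _) ⟨
    f 1 *ᵣ g 0 +ᵣ (f 0 *ᵣ g 1 +ᵣ 0#)   ∎
  *∞-sucʳ f g (suc n) = begin
    f 0 *ᵣ g (2 + n) +ᵣ (tail f *∞ g) (suc n)
      ≈⟨ +-congˡ (*∞-sucʳ (tail f) g n) ⟩
    f 0 *ᵣ g (2 + n) +ᵣ (f (2 + n) *ᵣ g 0 +ᵣ (tail f *∞ tail g) n)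
      ≈⟨ x∙yz≈y∙xz _ _ _ ⟩
    f (2 + n) *ᵣ g 0 +ᵣ (f *∞ tail g) (suc n) ∎
    where open CommutativeSemigroupProperties +-commutativeSemigroup using (x∙yz≈y∙xz)

  *∞-comm : ∀ f g → f *∞ g ≈∞ g *∞ f
  *∞-comm f g zero    = +-congʳ (*-comm (f 0) (g 0))
  *∞-comm f g (suc n) = begin
    f 0 *ᵣ g (suc n) +ᵣ (tail f *∞ g) n   ≈⟨ +-cong (*-comm _ _) (*∞-comm (tail f) g n) ⟩
    g (suc n) *ᵣ f 0 +ᵣ (g *∞ tail f) n   ≈⟨ *∞-sucʳ g f n ⟨
    (g *∞ f) (suc n)                    ∎

  *∞-zeroˡ : ∀ {f} g → f ≈∞ 0∞ → f *∞ g ≈∞ 0∞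
  *∞-zeroˡ g f≈0 zero    = trans (+-congʳ (trans (*-congʳ (f≈0 0)) (zeroˡ (g 0)))) (+-identityʳ 0#)
  *∞-zeroˡ g f≈0 (suc n) = trans
    (+-cong (trans (*-congʳ (f≈0 0)) (zeroˡ (g (suc n)))) (*∞-zeroˡ g (λ i → f≈0 (suc i)) n))
    (+-identityʳ 0#)

  *∞-const : ∀ f g → tail f ≈∞ 0∞ → ∀ n → (f *∞ g) n ≈ f 0 *ᵣ g n
  *∞-const f g e zero    = *∞-zero f g
  *∞-const f g e (suc n) = trans (+-congˡ (*∞-zeroˡ g e n)) (+-identityʳ _)

  *∞-identityˡ : ∀ f → 1∞ *∞ f ≈∞ f
  *∞-identityˡ f n = trans (*∞-const 1∞ f (λ _ → refl) n) (*-identityˡ (f n))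

  commutativeRing : CommutativeRing 0ℓ 0ℓ
  commutativeRing = record
    { isCommutativeRing = record
      { isRing = record
        { +-isAbelianGroup = Pointwise.isAbelianGroup ℕ +-isAbelianGroup
        ; *-cong           = *∞-cong
        ; *-assoc          = *∞-assoc
        ; *-identity       = *∞-identityˡ , λ f n → trans (*∞-comm f 1∞ n) (*∞-identityˡ f n)
        ; distrib          =
            (λ f g h n → trans (*∞-comm f (g +∞ h) n)
              (trans (*∞-distribʳ f g h n) (+-cong (*∞-comm g f n) (*∞-comm h f n))))
          , *∞-distribʳ
        }
      ; *-comm = *∞-comm
      }
    }

  private module ∞ = CommutativeRing commutativeRing
  open Exp ∞.semiring public using () renaming (_^_ to _^∞_)

  -- The one summand containing `g n` carries the factor `f 0`.
  *∞-zero-constʳ : ∀ f g h n → f 0 ≈ 0# → (∀ i → i < n → g i ≈ h i) → (f *∞ g) n ≈ (f *∞ h) n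
  *∞-zero-constʳ f g h zero    f₀ e = +-congʳ (trans (*-congʳ f₀)
    (trans (trans (zeroˡ (g 0)) (sym (zeroˡ (h 0)))) (*-congʳ (sym f₀))))
  *∞-zero-constʳ f g h (suc n) f₀ e = +-cong
    (trans (*-congʳ f₀) (trans (trans (zeroˡ (g (suc n))) (sym (zeroˡ (h (suc n))))) (*-congʳ (sym f₀))))
    (*∞-cong-≤ n {tail f} {tail f} {g} {h} (λ _ _ → refl) (λ i i≤n → e i (s≤s i≤n)))

  -- Multiplication by f raises the degree, so each coefficient of a solution is determined by the
  -- earlier ones. This supplies the cancellation hypothesis of `System-unique`.
  fixpoint-unique : ∀ {f a b c} → f 0 ≈ 0# → a ≈∞ (f *∞ a) +∞ c → b ≈∞ (f *∞ b) +∞ c → a ≈∞ b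
  fixpoint-unique {f} {a} {b} {c} f₀ ea eb n = below (suc n) n ℕ.≤-refl
    where
    below : ∀ k i → i < k → a i ≈ b i
    below (suc k) i (s≤s i≤k) = trans (ea i) (trans
      (+-congʳ (*∞-zero-constʳ f a b i f₀ λ j j<i → below k j (ℕ.<-≤-trans j<i i≤k)))
      (sym (eb i)))

  Order : ℕ → Seq → Set
  Order k f = ∀ i → i < k → f i ≈ 0#

  *∞-orderʳ : ∀ k f g → Order k g → Order k (f *∞ g)
  *∞-orderʳ k f g o i i<k = trans
    (*∞-cong-≤ i {f} {f} {g} {0∞} (λ _ _ → refl) (λ j j≤i → o j (ℕ.≤-<-trans j≤i i<k)))
    (∞.zeroʳ f i)

  *∞-order-suc : ∀ f g k → f 0 ≈ 0# → Order k g → Order (suc k) (f *∞ g)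
  *∞-order-suc f g k f₀ o i (s≤s i≤k) = trans
    (*∞-zero-constʳ f g 0∞ i f₀ (λ j j<i → o j (ℕ.<-≤-trans j<i i≤k)))
    (∞.zeroʳ f i)

  ^∞-order : ∀ f → f 0 ≈ 0# → ∀ k → Order k (f ^∞ k)
  ^∞-order f f₀ zero    i ()
  ^∞-order f f₀ (suc k) = *∞-order-suc f (f ^∞ k) k f₀ (^∞-order f f₀ k)

  ^∞-*-order : ∀ f g → f 0 ≈ 0# → ∀ k → Order k (f ^∞ k *∞ g)
  ^∞-*-order f g f₀ k i i<k = trans (*∞-comm (f ^∞ k) g i) (*∞-orderʳ k g (f ^∞ k) (^∞-order f f₀ k) i i<k)

  private module Sum = RawMonoidDefs +-rawMonoid

  -- Spelled like `1/_`, so that over `polyRing` the two agree by definition.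
  inverse : Seq → Seq
  inverse f n = Sum.sum {suc n} (λ k → ((1∞ +∞ (-∞ f)) ^∞ toℕ k) n)

  private
    module Geometric (g : Seq) (g₀ : g 0 ≈ 0#) where

      partial : ℕ → Seq
      partial N n = Sum.sum {N} (λ k → (g ^∞ toℕ k) n)

      *∞-sum : ∀ N (u : ℕ → Seq) n →
        Sum.sum {N} (λ k → (g *∞ u (toℕ k)) n) ≈ (g *∞ (λ i → Sum.sum {N} (λ k → u (toℕ k) i))) n
      *∞-sum zero    u n = sym (∞.zeroʳ g n)
      *∞-sum (suc N) u n = trans (+-congˡ (*∞-sum N (λ k → u (suc k)) n)) 
        (sym (∞.distribˡ g (u 0) (λ i → Sum.sum {N} (λ k → u (suc (toℕ k)) i)) n))

      partial-suc : ∀ N → partial (suc N) ≈∞ 1∞ +∞ (g *∞ partial N)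
      partial-suc N n = +-congˡ (*∞-sum N (g ^∞_) n)

      -- A power of g beyond the i-th has no coefficient at i, so the partial sums settle there; the
      -- proof peels one factor g from both sums.
      partial-stable : ∀ M N i → i < M → i < N → partial M i ≈ partial N i
      partial-stable (suc M) (suc N) i (s≤s i≤M) (s≤s i≤N) = trans (partial-suc M i) (trans
        (+-congˡ (*∞-zero-constʳ g (partial M) (partial N) i g₀
          (λ j j<i → partial-stable M N j (ℕ.<-≤-trans j<i i≤M) (ℕ.<-≤-trans j<i i≤N))))
        (sym (partial-suc N i)))

      limit : Seq
      limit n = partial (suc n) n

      limit-fixed : limit ≈∞ 1∞ +∞ (g *∞ limit)
      limit-fixed n = trans (partial-suc n n) (+-congˡ
        (*∞-zero-constʳ g (partial n) limit n g₀ (λ j j<n → partial-stable n (suc j) j j<n ℕ.≤-refl)))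

  *∞-inverseʳ : ∀ f → f 0 ≈ 1# → f *∞ inverse f ≈∞ 1∞
  *∞-inverseʳ f f₀ = Inverses.fixpoint⇒inverse commutativeRing f (inverse f) limit-fixed
    where open Geometric (1∞ +∞ (-∞ f)) (trans (+-congˡ (-‿cong f₀)) (-‿inverseʳ 1#))

  -- The diagonal is the limit for `Stable` families, where coefficient n is final from stage n on.
  lim : (ℕ → Seq) → Seq
  lim u n = u n n

  Stable : (ℕ → Seq) → Set
  Stable u = ∀ M n → n ≤ M → u (suc M) n ≈ u M n

  lim-stable : ∀ {u} → Stable u → ∀ M n → n ≤ M → u M n ≈ lim u n
  lim-stable {u} st M n n≤M = go (ℕ.≤⇒≤′ n≤M)
    where
    go : ∀ {M} → n ℕ.≤′ M → u M n ≈ lim u n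
    go (ℕ.≤′-reflexive ≡.refl) = refl
    go (ℕ.≤′-step n≤′M)        = trans (st _ n (ℕ.≤′⇒≤ n≤′M)) (go n≤′M)

  lim-*-stable : ∀ {u} → Stable u → ∀ f M n → n ≤ M → (f *∞ u M) n ≈ (f *∞ lim u) n
  lim-*-stable {u} st f M n n≤M = *∞-cong-≤ n {f} {f} {u M} {lim u} (λ _ _ → refl)
    (λ i i≤n → lim-stable {u} st M i (ℕ.≤-trans i≤n n≤M))

  module Variable (q : Seq) (q-zero : q 0 ≈ 0#) (q-tail : tail q ≈∞ 1∞) where

    q*-suc : ∀ f n → (q *∞ f) (suc n) ≈ f n
    q*-suc f n = trans (+-cong (trans (*-congʳ q-zero) (zeroˡ _))
      (trans (*∞-cong {tail q} {1∞} {f} {f} q-tail (λ _ → refl) n) (*∞-identityˡ f n))) (+-identityˡ _)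

    q*-zero : ∀ f → (q *∞ f) 0 ≈ 0#
    q*-zero f = trans (*∞-zero q f) (trans (*-congʳ q-zero) (zeroˡ _))

    -- Multiplication by q^k in a form that computes by recursion, in step with `compositionsFrom`
    -- in `firstPart-sum`.
    delay : ℕ → Seq → Seq
    delay zero    f n       = f n
    delay (suc k) f zero    = 0#
    delay (suc k) f (suc n) = delay k f n

    q^*-delay : ∀ k f → (q ^∞ k) *∞ f ≈∞ delay k f
    q^*-delay zero    f n       = *∞-identityˡ f n
    q^*-delay (suc k) f zero    = trans (*∞-assoc q (q ^∞ k) f 0) (q*-zero ((q ^∞ k) *∞ f))
    q^*-delay (suc k) f (suc n) = trans (*∞-assoc q (q ^∞ k) f (suc n))
      (trans (q*-suc ((q ^∞ k) *∞ f) n) (q^*-delay k f n))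

    open Counting ∞.commutativeSemiring q
    open Levels ∞.commutativeSemiring using (System)

    -- Raising the bound to M + 1 only adds partitions containing the part M + 1, whose size exceeds
    -- n.
    D-stable : ∀ d l → Stable (λ M → D d M l)
    D-stable d zero    M n n≤M = refl
    D-stable d (suc l) M n n≤M with d ℕ.≤? M
    ... | yes d≤M = trans (D-above l d≤M n) (trans
      (+-congˡ (^∞-*-order q (D d (maxNext M) l) q-zero (suc M) n (s≤s n≤M))) (+-identityʳ _))
    ... | no d≰M  = trans (D-below (suc M) l (ℕ.≰⇒> d≰M) n) (sym (D-below M l (ℕ.<⇒≤ (ℕ.≰⇒> d≰M)) n))

    D∞ : ℕ → ℕ → Seq
    D∞ d l = lim (λ M → D d M l)

    D∞-split : ∀ {d e} → Threshold d e → d < e → ∀ l →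
      D∞ d (suc l) ≈∞ D∞ (suc d) (suc l) +∞ ((q ^∞ suc d) *∞ D∞ e l)
    D∞-split {d} {e} θ d<e l n = begin
      D∞ d (suc l) n
        ≈⟨ lim-stable (D-stable d (suc l)) M n (ℕ.m≤n+m n (suc d)) ⟨
      D d M (suc l) n
        ≈⟨ D-split θ d<e l M (ℕ.m≤m+n (suc d) n) n ⟩
      D (suc d) M (suc l) n +ᵣ ((q ^∞ suc d) *∞ D e M l) n
        ≈⟨ +-cong (lim-stable (D-stable (suc d) (suc l)) M n (ℕ.m≤n+m n (suc d)))
                  (lim-*-stable {λ M → D e M l} (D-stable e l) (q ^∞ suc d) M n (ℕ.m≤n+m n (suc d))) ⟩
      D∞ (suc d) (suc l) n +ᵣ ((q ^∞ suc d) *∞ D∞ e l) n ∎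
      where
      M : ℕ
      -- Greater than d, as `D-split` requires, and at least n, so that all three families are
      -- stable at n.
      M = suc d + n

    D∞-shift : ∀ d l → D∞ (3 + d) l ≈∞ (q ^∞ (3 * l)) *∞ D∞ d l
    D∞-shift d l n = begin
      D∞ (3 + d) l n                     ≈⟨ lim-stable (D-stable (3 + d) l) (3 + n) n (ℕ.m≤n+m n 3) ⟨
      D (3 + d) (3 + n) l n              ≈⟨ D-shift d n l n ⟩
      ((q ^∞ (3 * l)) *∞ D d n l) n
        ≈⟨ lim-*-stable {λ M → D d M l} (D-stable d l) (q ^∞ (3 * l)) n n ℕ.≤-refl ⟩
      ((q ^∞ (3 * l)) *∞ D∞ d l) n       ∎

    system : System q (D∞ 0) (D∞ 1) (D∞ 2)
    system = D∞-system D∞ (λ _ _ → refl) D∞-split D∞-shift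

-- The ring of polynomials over the integers.

module ℤ⟦⟧ = PowerSeries ℤ.+-*-commutativeRing

coeff-+ : ∀ p r k → coeff (p +ₚ r) k ≡ coeff p k ℤ.+ coeff r k
coeff-+ []      r       k       = ≡.sym (ℤ.+-identityˡ _)
coeff-+ (a ∷ p) []      k       = ≡.sym (ℤ.+-identityʳ _)
coeff-+ (a ∷ p) (b ∷ r) zero    = ≡.refl
coeff-+ (a ∷ p) (b ∷ r) (suc k) = coeff-+ p r k

coeff-map : ∀ (f : ℤ.ℤ → ℤ.ℤ) → f ℤ.0ℤ ≡ ℤ.0ℤ → ∀ p k → coeff (map f p) k ≡ f (coeff p k)
coeff-map f f0 []      k       = ≡.sym f0
coeff-map f f0 (a ∷ p) zero    = ≡.refl
coeff-map f f0 (a ∷ p) (suc k) = coeff-map f f0 p k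

coeff-1 : ∀ k → coeff (RawRing.1# ℤ[x]) k ≡ ℤ⟦⟧.1∞ k
coeff-1 zero    = ≡.refl
coeff-1 (suc k) = ≡.refl

coeff-* : ∀ p r k → coeff (p *ₚ r) k ≡ (coeff p ℤ⟦⟧.*∞ coeff r) k
coeff-* []      r k       = ≡.sym (CommutativeRing.zeroˡ ℤ⟦⟧.commutativeRing (coeff r) k)
coeff-* (a ∷ p) r zero    = ≡.trans (coeff-+ (map (a ℤ.*_) r) (ℤ.0ℤ ∷ p *ₚ r) 0)
  (≡.cong (ℤ._+ ℤ.0ℤ) (coeff-map (a ℤ.*_) (ℤ.*-zeroʳ a) r 0))
coeff-* (a ∷ p) r (suc k) = ≡.trans (coeff-+ (map (a ℤ.*_) r) (ℤ.0ℤ ∷ p *ₚ r) (suc k))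
  (≡.cong₂ ℤ._+_ (coeff-map (a ℤ.*_) (ℤ.*-zeroʳ a) r (suc k)) (coeff-* p r k))

-- Equality of polynomials is equality of their coefficient sequences, so the ring laws are pulled
-- back from power series over ℤ.
coeff-isRingMonomorphism : IsRingMonomorphism ℤ[x] (CommutativeRing.rawRing ℤ⟦⟧.commutativeRing) coeff
coeff-isRingMonomorphism = record
  { isRingHomomorphism = record
    { isSemiringHomomorphism = record
      { isNearSemiringHomomorphism = record
        { +-isMonoidHomomorphism = record
          { isMagmaHomomorphism = record
            { isRelHomomorphism = record { cong = at }
            ; homo = coeff-+
            }
          ; ε-homo = λ _ → ≡.refl
          }
        ; *-homo = coeff-*
        }
      ; 1#-homo = coeff-1
      }
    ; -‿homo = coeff-map (λ a → ℤ.- a) ≡.refl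
    }
  ; injective = coeffwise
  }

polyRing : CommutativeRing 0ℓ 0ℓ
polyRing = record
  { isCommutativeRing = RingMonomorphism.isCommutativeRing coeff-isRingMonomorphism
      (CommutativeRing.isCommutativeRing ℤ⟦⟧.commutativeRing)
  }

module ℤ[x]⟦⟧ = PowerSeries polyRing

-- From the list of Schur partitions to a recursion in the largest part.

First≤ : ℕ → List ℕ → Set
First≤ M []      = ⊤
First≤ M (b ∷ _) = b ≤ M

IsSchur-tail : ∀ {b c} → IsSchur (suc b ∷ c) → IsSchur c × First≤ (maxNext b) c
IsSchur-tail {c = []}    _ = (([] , []) , []) , _
IsSchur-tail {c = _ ∷ _} ((_ ∷ ps , _ ∷ ls) , gap ∷ gs) = ((ps , ls) , gs) , SchurGap⇒≤maxNext gap

IsSchur-∷ : ∀ {b c} → IsSchur c → First≤ (maxNext b) c → IsSchur (suc b ∷ c)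
IsSchur-∷ {c = []}    _ _ = (s≤s z≤n ∷ [] , [-]) , [-]
IsSchur-∷ {b} {c ∷ _} ((p ∷ ps , ls) , gs) c≤ =
  (s≤s z≤n ∷ p ∷ ps , ℕ.≤-trans c≤ (ℕ.m≤n⇒m≤1+n (maxNext≤ b)) ∷ ls) , ≤maxNext⇒SchurGap p c≤ ∷ gs

compositionsFrom-First≤ : ∀ a n → All (First≤ (suc (a + n))) (compositionsFrom a n)
compositionsFrom-First≤ a zero    = s≤s (ℕ.m≤m+n a 0) ∷ []
compositionsFrom-First≤ a (suc n) = All.++⁺
  (≡.subst (λ k → All (First≤ (suc k)) (compositionsFrom (suc a) n)) (≡.sym (ℕ.+-suc a n))
    (compositionsFrom-First≤ (suc a) n))
  (All.map⁺ (All.universal (λ _ → s≤s (ℕ.m≤m+n a (suc n))) _))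

compositions-First≤ : ∀ n → All (First≤ n) (compositions n)
compositions-First≤ zero    = _ ∷ []
compositions-First≤ (suc n) = compositionsFrom-First≤ 0 n

module ListSum (K : CommutativeSemiring 0ℓ 0ℓ) where

  open CommutativeSemiring K renaming (_+_ to _+ᵏ_; _*_ to _*ᵏ_)
  open CommutativeSemigroupProperties +-commutativeSemigroup using (interchange)

  listSum : ∀ {A : Set} → (A → Carrier) → List A → Carrier
  listSum f as = foldr _+ᵏ_ 0# (map f as)

  module _ {A : Set} where

    listSum-cong : ∀ {f g : A → Carrier} {as} → All (λ a → f a ≈ g a) as → listSum f as ≈ listSum g as
    listSum-cong []       = refl
    listSum-cong (e ∷ es) = +-cong e (listSum-cong es)

    listSum-++ : ∀ (f : A → Carrier) as bs → listSum f (as ++ bs) ≈ listSum f as +ᵏ listSum f bs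
    listSum-++ f []       bs = sym (+-identityˡ _)
    listSum-++ f (a ∷ as) bs = trans (+-congˡ (listSum-++ f as bs)) (sym (+-assoc _ _ _))

    listSum-+ : ∀ (f g : A → Carrier) as → listSum (λ a → f a +ᵏ g a) as ≈ listSum f as +ᵏ listSum g as
    listSum-+ f g []       = sym (+-identityˡ 0#)
    listSum-+ f g (a ∷ as) = trans (+-congˡ (listSum-+ f g as)) (interchange _ _ _ _)

    listSum-* : ∀ b (f : A → Carrier) as → listSum (λ a → b *ᵏ f a) as ≈ b *ᵏ listSum f as
    listSum-* b f []       = sym (zeroʳ b)
    listSum-* b f (a ∷ as) = trans (+-congˡ (listSum-* b f as)) (sym (distribˡ b _ _))

    listSum-zero : ∀ {f : A → Carrier} {as} → All (λ a → f a ≈ 0#) as → listSum f as ≈ 0#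
    listSum-zero []       = refl
    listSum-zero (e ∷ es) = trans (+-cong e (listSum-zero es)) (+-identityˡ 0#)

    listSum-filter : ∀ {P : Pred A 0ℓ} (P? : Decidable P) (f : A → Carrier) as →
      listSum f (filter P? as) ≈ listSum (λ a → if does (P? a) then f a else 0#) as
    listSum-filter P? f []       = refl
    listSum-filter P? f (a ∷ as) with does (P? a)
    ... | true  = +-congˡ (listSum-filter P? f as)
    ... | false = trans (listSum-filter P? f as) (sym (+-identityˡ _))

  listSum-map : ∀ {A B : Set} (f : B → Carrier) (g : A → B) as →
    listSum f (map g as) ≡ listSum (λ a → f (g a)) as
  listSum-map f g []       = ≡.refl
  listSum-map f g (a ∷ as) = ≡.cong (f (g a) +ᵏ_) (listSum-map f g as)

open CommutativeRing polyRing using (_≈_; refl; reflexive; sym; trans; setoid)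
  renaming ( +-congˡ to +ₚ-congˡ; *-congˡ to *ₚ-congˡ; +-identityʳ to +ₚ-identityʳ; zeroʳ to *ₚ-zeroʳ
           ; +-cong to +ₚ-cong; *-cong to *ₚ-cong; *-congʳ to *ₚ-congʳ
           ; *-identityˡ to *ₚ-identityˡ; zeroˡ to *ₚ-zeroˡ
           ; -‿cong to -ₚ-cong; commutativeSemiring to polySemiring; ring to polyRing′ )
open ListSum polySemiring
open RawSemiringDefs (RawRing.rawSemiring ℤ[x]) using () renaming (_^_ to _^ₚ_)
open SetoidReasoning setoid

q-tail : ∀ n → q (suc n) ≈ 1ˢ n
q-tail zero    = refl
q-tail (suc n) = refl

open ℤ[x]⟦⟧ using (*∞-const)
open ℤ[x]⟦⟧.Variable q refl q-tail using (delay; q^*-delay)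

-- The monomial x^length on Schur partitions with first part at most M, and zero on all other lists.
-- It tests one part at a time against a running bound, which makes it recursive in M, unlike a
-- filter by `isSchur?`.
schurWeight : ℕ → List ℕ → Poly
schurWeight M []          = RawRing.1# ℤ[x]
schurWeight M (zero ∷ c)  = []
schurWeight M (suc b ∷ c) = if b <ᵇ M then X *ₚ schurWeight (maxNext b) c else []

schurWeight-∷ : ∀ {M b} c → b < M → schurWeight M (suc b ∷ c) ≡ X *ₚ schurWeight (maxNext b) c
schurWeight-∷ {M} {b} c b<M with b <ᵇ M in eq
... | true  = ≡.refl
... | false = contradiction (≡.subst T eq (ℕ.<⇒<ᵇ b<M)) λ ()

schurWeight-∷-0 : ∀ {M b} c → M ≤ b → schurWeight M (suc b ∷ c) ≡ []
schurWeight-∷-0 {M} {b} c M≤b with b <ᵇ M in eq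
... | true  = contradiction M≤b (ℕ.<⇒≱ (ℕ.<ᵇ⇒< b M (≡.subst T (≡.sym eq) _)))
... | false = ≡.refl

schurWeight-IsSchur : ∀ M c → IsSchur c → First≤ M c → schurWeight M c ≈ X ^ₚ length c
schurWeight-IsSchur M []          s h = refl
schurWeight-IsSchur M (zero ∷ c)  ((() ∷ _ , _) , _) h
schurWeight-IsSchur M (suc b ∷ c) s h rewrite schurWeight-∷ {M} {b} c h =
  *ₚ-congˡ {X} (schurWeight-IsSchur (maxNext b) c (proj₁ (IsSchur-tail s)) (proj₂ (IsSchur-tail s)))

schurWeight-dichotomy : ∀ M c → schurWeight M c ≈ [] ⊎ IsSchur c × First≤ M c
schurWeight-dichotomy M []          = inj₂ ((([] , []) , []) , _)
schurWeight-dichotomy M (zero ∷ c)  = inj₁ refl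
schurWeight-dichotomy M (suc b ∷ c) with b <ᵇ M in eq
... | false = inj₁ refl
... | true with schurWeight-dichotomy (maxNext b) c
...   | inj₁ e       = inj₁ (trans (*ₚ-congˡ {X} e) (*ₚ-zeroʳ X))
...   | inj₂ (s , h) = inj₂ (IsSchur-∷ s h , ℕ.<ᵇ⇒< b M (≡.subst T (≡.sym eq) _))

schurWeight-correct : ∀ M c → First≤ M c →
  schurWeight M c ≈ (if does (isSchur? c) then X ^ₚ length c else [])
schurWeight-correct M c h = decide (isSchur? c)
  where
  decide : (s? : Dec (IsSchur c)) → schurWeight M c ≈ (if does s? then X ^ₚ length c else [])
  decide (yes s) = schurWeight-IsSchur M c s h
  decide (no ¬s) = [ id , (λ s → contradiction (proj₁ s) ¬s) ]′ (schurWeight-dichotomy M c)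

-- The generating function of the Schur partitions with all parts at most M.
Φ : ℕ → Series
Φ M n = listSum (schurWeight M) (compositions n)

-- No part of a composition of n exceeds n, so the bound n is no restriction.
fS≈Φ : ∀ n → fS n ≈ Φ n n
fS≈Φ n = trans (listSum-filter isSchur? (λ c → X ^ₚ length c) (compositions n))
  (listSum-cong (All.map (λ {c} h → sym (schurWeight-correct n c h)) (compositions-First≤ n)))

compositionsFrom-zero : ∀ (f : List ℕ → Poly) a n → (∀ b c → a ≤ b → f (suc b ∷ c) ≈ []) →
  listSum f (compositionsFrom a n) ≈ []
compositionsFrom-zero f a zero    e = trans (+ₚ-identityʳ _) (e a [] ℕ.≤-refl)
compositionsFrom-zero f a (suc n) e = begin
  listSum f (compositionsFrom (suc a) n ++ map (suc a ∷_) (compositionsFrom 0 n))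
    ≈⟨ listSum-++ f (compositionsFrom (suc a) n) _ ⟩
  listSum f (compositionsFrom (suc a) n) +ₚ listSum f (map (suc a ∷_) (compositionsFrom 0 n))
    ≡⟨ ≡.cong (listSum f (compositionsFrom (suc a) n) +ₚ_) (listSum-map f (suc a ∷_) (compositionsFrom 0 n)) ⟩
  listSum f (compositionsFrom (suc a) n) +ₚ listSum (λ c → f (suc a ∷ c)) (compositionsFrom 0 n)
    ≈⟨ +ₚ-cong (compositionsFrom-zero f (suc a) n (λ b c a<b → e b c (ℕ.<⇒≤ a<b)))
               (listSum-zero (All.universal (λ c → e a c ℕ.≤-refl) (compositionsFrom 0 n))) ⟩
  [] ∎

Φ-zero : Φ 0 ≈ˢ 1ˢ
Φ-zero zero    = refl
Φ-zero (suc n) = compositionsFrom-zero (schurWeight 0) 0 n (λ b c _ → refl)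

-- The increment from `schurWeight M` to `schurWeight (suc M)`, carried by the lists with first part
-- exactly 1 + M.
firstPart : ℕ → List ℕ → Poly
firstPart M []          = []
firstPart M (zero ∷ c)  = []
firstPart M (suc b ∷ c) = if b ≡ᵇ M then X *ₚ schurWeight (maxNext M) c else []

firstPart-≡ : ∀ M c → firstPart M (suc M ∷ c) ≡ X *ₚ schurWeight (maxNext M) c
firstPart-≡ M c with M ≡ᵇ M in eq
... | true  = ≡.refl
... | false = contradiction (≡.subst T eq (ℕ.≡⇒≡ᵇ M M ≡.refl)) λ ()

firstPart-≢ : ∀ {M b} c → b ≢ M → firstPart M (suc b ∷ c) ≡ []
firstPart-≢ {M} {b} c b≢M with b ≡ᵇ M in eq
... | true  = contradiction (ℕ.≡ᵇ⇒≡ b M (≡.subst T (≡.sym eq) _)) b≢M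
... | false = ≡.refl

schurWeight-suc : ∀ M c → schurWeight (suc M) c ≈ schurWeight M c +ₚ firstPart M c
schurWeight-suc M []          = refl
schurWeight-suc M (zero ∷ c)  = refl
schurWeight-suc M (suc b ∷ c) with ℕ.<-cmp b M
... | tri< b<M b≢M _ rewrite schurWeight-∷ c b<M | schurWeight-∷ c (ℕ.m≤n⇒m≤1+n b<M) | firstPart-≢ c b≢M =
  sym (+ₚ-identityʳ (X *ₚ schurWeight (maxNext b) c))
... | tri≈ _ ≡.refl _ rewrite schurWeight-∷-0 c (ℕ.≤-refl {M}) | schurWeight-∷ c (ℕ.n<1+n M) | firstPart-≡ M c =
  refl
... | tri> _ b≢M M<b rewrite schurWeight-∷-0 c M<b | schurWeight-∷-0 c (ℕ.<⇒≤ M<b) | firstPart-≢ c b≢M = refl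

m+1+n≡o⇒m≢o : ∀ {m n o} → m + suc n ≡ o → m ≢ o
m+1+n≡o⇒m≢o {m} ≡.refl = ℕ.<⇒≢ (ℕ.m<m+n m (s≤s z≤n))

firstPart-sum : ∀ M k a n → a + k ≡ M →
  listSum (firstPart M) (compositionsFrom a n) ≈ delay k (x ⊙ Φ (maxNext M)) n
firstPart-sum M zero a n a≡M rewrite ≡.trans (≡.sym (ℕ.+-identityʳ a)) a≡M =
  trans (base n) (sym (*∞-const x (Φ (maxNext M)) (λ _ → refl) n))
  where
  base : ∀ n → listSum (firstPart M) (compositionsFrom M n) ≈ X *ₚ Φ (maxNext M) n
  base zero rewrite firstPart-≡ M [] = +ₚ-identityʳ (X *ₚ (RawRing.1# ℤ[x]))
  base (suc n) = begin
    listSum (firstPart M) (compositionsFrom (suc M) n ++ map (suc M ∷_) (compositionsFrom 0 n))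
      ≈⟨ listSum-++ (firstPart M) (compositionsFrom (suc M) n) _ ⟩
    listSum (firstPart M) (compositionsFrom (suc M) n)
      +ₚ listSum (firstPart M) (map (suc M ∷_) (compositions (suc n)))
      ≈⟨ +ₚ-cong
           (compositionsFrom-zero (firstPart M) (suc M) n
             (λ b c M<b → reflexive (firstPart-≢ c (ℕ.>⇒≢ M<b))))
           (reflexive (listSum-map (firstPart M) (suc M ∷_) (compositions (suc n)))) ⟩
    listSum (λ c → firstPart M (suc M ∷ c)) (compositions (suc n))
      ≈⟨ listSum-cong (All.universal (λ c → reflexive (firstPart-≡ M c)) (compositions (suc n))) ⟩
    listSum (λ c → X *ₚ schurWeight (maxNext M) c) (compositions (suc n))
      ≈⟨ listSum-* X (schurWeight (maxNext M)) (compositions (suc n)) ⟩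
    X *ₚ Φ (maxNext M) (suc n) ∎
firstPart-sum M (suc k) a zero    a+k≡M = trans (+ₚ-identityʳ _)
  (reflexive (firstPart-≢ [] (m+1+n≡o⇒m≢o a+k≡M)))
firstPart-sum M (suc k) a (suc n) a+k≡M = begin
  listSum (firstPart M) (compositionsFrom (suc a) n ++ map (suc a ∷_) (compositionsFrom 0 n))
    ≈⟨ listSum-++ (firstPart M) (compositionsFrom (suc a) n) _ ⟩
  listSum (firstPart M) (compositionsFrom (suc a) n)
    +ₚ listSum (firstPart M) (map (suc a ∷_) (compositionsFrom 0 n))
    ≈⟨ +ₚ-cong (firstPart-sum M k (suc a) n (≡.trans (≡.sym (ℕ.+-suc a k)) a+k≡M))
         (trans (reflexive (listSum-map (firstPart M) (suc a ∷_) (compositionsFrom 0 n)))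
                (listSum-zero (All.universal (λ c → reflexive (firstPart-≢ c (m+1+n≡o⇒m≢o a+k≡M)))
                  (compositionsFrom 0 n)))) ⟩
  delay k (x ⊙ Φ (maxNext M)) n +ₚ []
    ≈⟨ +ₚ-identityʳ _ ⟩
  delay k (x ⊙ Φ (maxNext M)) n ∎
Φ-suc : ∀ M → Φ (suc M) ≈ˢ Φ M ⊕ (q ↑ suc M) ⊙ (x ⊙ Φ (maxNext M))
Φ-suc M n = begin
  Φ (suc M) n
    ≈⟨ listSum-cong (All.universal (schurWeight-suc M) (compositions n)) ⟩
  listSum (λ c → schurWeight M c +ₚ firstPart M c) (compositions n)
    ≈⟨ listSum-+ (schurWeight M) (firstPart M) (compositions n) ⟩
  Φ M n +ₚ listSum (firstPart M) (compositions n)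
    ≈⟨ +ₚ-congˡ {Φ M n} (trans (delayed n) (sym (q^*-delay (suc M) (x ⊙ Φ (maxNext M)) n))) ⟩
  Φ M n +ₚ ((q ↑ suc M) ⊙ (x ⊙ Φ (maxNext M))) n ∎
  where
  delayed : ∀ n → listSum (firstPart M) (compositions n) ≈ delay (suc M) (x ⊙ Φ (maxNext M)) n
  delayed zero    = refl
  -- `compositions (suc n)` starts from first part 1, which uses up one of the `suc M` delays.
  delayed (suc n) = firstPart-sum M M 0 n ≡.refl

-- The double series over ℤ[x] and the final comparison.

module 𝕊 = CommutativeRing ℤ[x]⟦⟧.commutativeRing

open Levels 𝕊.commutativeSemiring
open Counting 𝕊.commutativeSemiring q using (D; total; total-D)
open ℤ[x]⟦⟧ using (*∞-zero; *∞-orderʳ; ^∞-order; *∞-inverseʳ; lim-*-stable; fixpoint-unique; Order)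
open ℤ[x]⟦⟧.Variable q refl q-tail using (D∞; D-stable) renaming (system to D∞-system)

-- The index pairs of `levelSum`, listed in its order of summation.
pairs : ℕ → List (ℕ × ℕ)
pairs 0             = (0 , 0) ∷ []
pairs 1             = (1 , 0) ∷ []
pairs (suc (suc l)) = (2 + l , 0) ∷ map (map₂ suc) (pairs l)

pairs-weight : ∀ l → All (λ i → uncurry weight i ≡ l) (pairs l)
pairs-weight 0             = ≡.refl ∷ []
pairs-weight 1             = ≡.refl ∷ []
pairs-weight (suc (suc l)) = ℕ.+-identityʳ (2 + l)
  ∷ All.map⁺ (All.map (λ {i} e → ≡.trans (uncurry weight-suc i) (≡.cong (2 +_) e)) (pairs-weight l))

pairs-unique : ∀ l → Unique (pairs l)
pairs-unique 0             = [] ∷ []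
pairs-unique 1             = [] ∷ []
pairs-unique (suc (suc l)) = All.map⁺ (All.universal (λ _ ()) (pairs l))
  ∷ Unique.map⁺ (λ { {_ , _} {_ , _} ≡.refl → ≡.refl }) (pairs-unique l)

pairs-complete : ∀ m n l → weight m n ≡ l → (m , n) ∈ pairs l
pairs-complete 0             zero    _ ≡.refl = here ≡.refl
pairs-complete 1             zero    _ ≡.refl = here ≡.refl
pairs-complete (suc (suc m)) zero    _ ≡.refl = here (≡.cong (_, 0) (≡.sym (ℕ.+-identityʳ (2 + m))))
pairs-complete m             (suc n) _ ≡.refl rewrite weight-suc m n =
  there (∈-map⁺ (map₂ suc) (pairs-complete m n (weight m n) ≡.refl))

pairsUpTo : ℕ → List (ℕ × ℕ)
pairsUpTo zero    = pairs 0
pairsUpTo (suc l) = pairsUpTo l ++ pairs (suc l)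

pairsUpTo-weight : ∀ l → All (λ i → uncurry weight i ≤ l) (pairsUpTo l)
pairsUpTo-weight zero    = z≤n ∷ []
pairsUpTo-weight (suc l) = All.++⁺ (All.map ℕ.m≤n⇒m≤1+n (pairsUpTo-weight l))
  (All.map ℕ.≤-reflexive (pairs-weight (suc l)))

pairsUpTo-unique : ∀ l → Unique (pairsUpTo l)
pairsUpTo-unique zero    = [] ∷ []
pairsUpTo-unique (suc l) = Unique.++⁺ (pairsUpTo-unique l) (pairs-unique (suc l))
  λ (i∈ , i∈′) → ℕ.<⇒≢ (s≤s (All.lookup (pairsUpTo-weight l) i∈)) (All.lookup (pairs-weight (suc l)) i∈′)

pairsUpTo-complete : ∀ m n l → weight m n ≤ l → (m , n) ∈ pairsUpTo l
pairsUpTo-complete m n zero    w = pairs-complete m n 0 (ℕ.n≤0⇒n≡0 w)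
pairsUpTo-complete m n (suc l) w with weight m n ℕ.≤? l
... | yes w≤l = ∈-++⁺ˡ (pairsUpTo-complete m n l w≤l)
... | no w≰l  = ∈-++⁺ʳ (pairsUpTo l) (pairs-complete m n (suc l) (ℕ.≤-antisym w (ℕ.≰⇒> w≰l)))

listSum-pairs : ∀ (t : ℕ → ℕ → Series) N l → listSum (λ i → uncurry t i N) (pairs l) ≈ levelSum t l N
listSum-pairs t N 0             = +ₚ-identityʳ (t 0 0 N)
listSum-pairs t N 1             = +ₚ-identityʳ (t 1 0 N)
listSum-pairs t N (suc (suc l)) = +ₚ-congˡ {t (2 + l) 0 N} (trans
  (reflexive (listSum-map (λ i → uncurry t i N) (map₂ suc) (pairs l)))
  (listSum-pairs (λ m n → t m (suc n)) N l))

listSum-pairsUpTo : ∀ (t : ℕ → ℕ → Series) N l →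
  listSum (λ i → uncurry t i N) (pairsUpTo l) ≈ total (levelSum t) l N
listSum-pairsUpTo t N zero    = listSum-pairs t N 0
listSum-pairsUpTo t N (suc l) = trans
  (listSum-++ (λ i → uncurry t i N) (pairsUpTo l) (pairs (suc l)))
  (+ₚ-cong (listSum-pairsUpTo t N l) (listSum-pairs t N (suc l)))

⊙-const-1 : ∀ f g → f 0 ≈ 1ˢ 0 → g 0 ≈ 1ˢ 0 → (f ⊙ g) 0 ≈ 1ˢ 0
⊙-const-1 f g f₀ g₀ = trans (*∞-zero f g) (trans (*ₚ-cong f₀ g₀) (*ₚ-identityˡ (1ˢ 0)))

pochhammer-const-1 : ∀ a b → a 0 ≈ 0ˢ 0 → ∀ n → (⟨ a ⨾ b ⟩ n) 0 ≈ 1ˢ 0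
pochhammer-const-1 a b a₀ zero    = refl
pochhammer-const-1 a b a₀ (suc n) = ⊙-const-1 (⟨ a ⨾ b ⟩ n) (1ˢ ⊕ (⊖ (a ⊙ b ↑ n)))
  (pochhammer-const-1 a b a₀ n)
  (trans (+ₚ-congˡ {1ˢ 0} (trans (-ₚ-cong
     (trans (*∞-zero a (b ↑ n)) (trans (*ₚ-congʳ {(b ↑ n) 0} a₀) (*ₚ-zeroˡ ((b ↑ n) 0))))) -0#≈0#))
     (+ₚ-identityʳ (1ˢ 0)))
  where open RingProperties polyRing′ using (-0#≈0#)

denominator : ℕ → ℕ → Series
denominator m n = ⟨ q ⨾ q ⟩ m ⊙ ⟨ q ↑ 6 ⨾ q ↑ 6 ⟩ n

denominator-inverse : ∀ m n → denominator m n ⊙ 1/ denominator m n ≈ˢ 1ˢ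
denominator-inverse m n = *∞-inverseʳ (denominator m n)
  (⊙-const-1 (⟨ q ⨾ q ⟩ m) (⟨ q ↑ 6 ⨾ q ↑ 6 ⟩ n)
    (pochhammer-const-1 q q refl m)
    (pochhammer-const-1 (q ↑ 6) (q ↑ 6) (^∞-order q refl 6 0 (s≤s z≤n)) n))

open Inverses ℤ[x]⟦⟧.commutativeRing using (inverse-*-1-t)

1/denominator-zero : 1/ denominator 0 0 ≈ˢ 1ˢ
1/denominator-zero = 𝕊.trans (𝕊.sym {f ⊙ i} {i} (𝕊.trans {f ⊙ i} {1ˢ ⊙ i} {i}
  (𝕊.*-congʳ {i} (𝕊.*-identityˡ 1ˢ)) (𝕊.*-identityˡ i))) (denominator-inverse 0 0)
  where
  f i : Series
  f = denominator 0 0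
  i = 1/ f

-- The new factor of (q;q)_(m+1) is 1 - q q^m, and `q ⊙ q ↑ m` is `q ↑ suc m` by definition.
1/denominator-sucᵐ : ∀ m n → 1/ denominator (suc m) n ≈ˢ
  1/ denominator m n ⊕ q ↑ suc m ⊙ 1/ denominator (suc m) n
1/denominator-sucᵐ m n = inverse-*-1-t {denominator m n} {denominator (suc m) n} (q ↑ suc m)
  (denominator-inverse m n) (denominator-inverse (suc m) n)
  (xy∙z≈xz∙y (⟨ q ⨾ q ⟩ m) (1ˢ ⊕ (⊖ (q ↑ suc m))) (⟨ q ↑ 6 ⨾ q ↑ 6 ⟩ n))
  where open CommutativeSemigroupProperties 𝕊.*-commutativeSemigroup using (xy∙z≈xz∙y)

1/denominator-sucⁿ : ∀ m n → 1/ denominator m (suc n) ≈ˢ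
  1/ denominator m n ⊕ q ↑ (6 * suc n) ⊙ 1/ denominator m (suc n)
1/denominator-sucⁿ m n = 𝕊.trans
  (inverse-*-1-t {denominator m n} {denominator m (suc n)} ((q ↑ 6) ↑ suc n)
    (denominator-inverse m n) (denominator-inverse m (suc n))
    (𝕊.sym (𝕊.*-assoc (⟨ q ⨾ q ⟩ m) (⟨ q ↑ 6 ⨾ q ↑ 6 ⟩ n) (1ˢ ⊕ (⊖ ((q ↑ 6) ↑ suc n))))))
  (𝕊.+-congˡ {1/ denominator m n}
    (𝕊.*-congʳ {1/ denominator m (suc n)} (Exp.^-assocʳ 𝕊.semiring q 6 (suc n))))

open DoubleSum q (⊖ 1ˢ) (𝕊.-‿inverseʳ 1ˢ) (λ m n → 1/ denominator m n)
  1/denominator-zero 1/denominator-sucᵐ 1/denominator-sucⁿ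
  qExponent ≡.refl qExponent-sucᵐ qExponent-sucⁿ

term : ℕ → ℕ → Series
term m n = (⊖ 1ˢ) ↑ n ⊙ x ↑ weight m n ⊙ q ↑ qExponent m n ⊙ 1/ denominator m n

term-order : ∀ m n → Order (qExponent m n) (term m n)
term-order m n i i< = trans (𝕊.*-comm a (1/ denominator m n) i)
  (*∞-orderʳ e (1/ denominator m n) a (*∞-orderʳ e b (q ↑ e) (^∞-order q refl e)) i i<)
  where
  e : ℕ
  e = qExponent m n
  a b : Series
  b = (⊖ 1ˢ) ↑ n ⊙ x ↑ weight m n
  a = b ⊙ q ↑ e

-- The exponent of x is the weight, so its power is constant on a level and leaves the sum.
levelSum-term : ∀ l → levelSum term l ≈ˢ x ↑ l ⊙ levelSum qTerm l
levelSum-term l = 𝕊.trans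
  (levelSum-cong l (λ m n _ →
    rearrange ((⊖ 1ˢ) ↑ n) (x ↑ weight m n) (q ↑ qExponent m n) (1/ denominator m n)))
  (levelSum-^ x qTerm l)
  where
  open CommutativeSemigroupProperties 𝕊.*-commutativeSemigroup using (xy∙z≈y∙xz)
  rearrange : ∀ a b c d → a ⊙ b ⊙ c ⊙ d ≈ˢ b ⊙ (a ⊙ (c ⊙ d))
  rearrange a b c d = 𝕊.trans (𝕊.*-assoc (a ⊙ b) c d) (xy∙z≈y∙xz a b (c ⊙ d))

-- The identity for a fixed number l of parts: both sides solve the `System`, and q^(k+1) has no
-- constant term.
D∞≈levelSum-qTerm : ∀ l → D∞ 0 l ≈ˢ levelSum qTerm l
D∞≈levelSum-qTerm l = 𝕊.trans
  (System-unique (λ k {a} {b} {c} → fixpoint-unique {q ↑ suc k} {a} {b} {c}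
      (^∞-order q refl (suc k) 0 (s≤s z≤n)))
    D∞-system system l)
  (L₀≈ l)

-- Needed at a single coefficient because `D 0 N l` agrees with its limit only up to degree N.
total-cong-at : ∀ {u v : ℕ → Series} N → (∀ l → u l N ≈ v l N) → ∀ n → total u n N ≈ total v n N
total-cong-at N e zero    = e 0
total-cong-at N e (suc n) = +ₚ-cong (total-cong-at N e n) (e (suc n))

-- For the coefficient of q^N, part sizes, numbers of parts and weights may all be cut off at N.
fS≈term : ∀ N → fS N ≈ listSum (λ i → uncurry term i N) (pairsUpTo N)
fS≈term N = begin
  fS N                                             ≈⟨ fS≈Φ N ⟩
  Φ N N                                            ≈⟨ total-D x Φ Φ-zero Φ-suc N N ℕ.≤-refl N ⟩
  total (λ l → x ↑ l ⊙ D 0 N l) N N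
    ≈⟨ total-cong-at {λ l → x ↑ l ⊙ D 0 N l} {levelSum term} N levels N ⟩
  total (levelSum term) N N                           ≈⟨ listSum-pairsUpTo term N N ⟨
  listSum (λ i → uncurry term i N) (pairsUpTo N)      ∎
  where
  levels : ∀ l → (x ↑ l ⊙ D 0 N l) N ≈ levelSum term l N
  levels l = begin
    (x ↑ l ⊙ D 0 N l) N         ≈⟨ lim-*-stable {λ M → D 0 M l} (D-stable 0 l) (x ↑ l) N N ℕ.≤-refl ⟩
    (x ↑ l ⊙ D∞ 0 l) N          ≈⟨ 𝕊.*-congˡ {x ↑ l} (D∞≈levelSum-qTerm l) N ⟩
    (x ↑ l ⊙ levelSum qTerm l) N    ≈⟨ levelSum-term l N ⟨
    levelSum term l N              ∎

theorem1p1 : HasSum {ℕ × ℕ} U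
    (uncurry λ m n →
    (⊖ 1ˢ) ↑ n ⊙ x ↑ (m + 2 * n) ⊙ q ↑ (3 * n * (3 * n + 2 * m) + m * (3 * m ∸ 1) / 2)
    ⊙ 1/ (⟨ q ⨾ q ⟩ m ⊙ ⟨ q ↑ 6 ⨾ q ↑ 6 ⟩ n))
    fS
theorem1p1 N = pairsUpTo N
  , pairsUpTo-unique N
  , All.universal _ (pairsUpTo N)
  -- A pair outside the list has weight above N, hence an exponent of q above N.
  , (λ (m , n) _ ∉pairs → term-order m n N (ℕ.<-≤-trans
      (ℕ.≰⇒> (λ w≤N → ∉pairs (pairsUpTo-complete m n N w≤N))) (weight≤qExponent m n)))
  , fS≈term N
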